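{- (1) $SU^d$ is a dividing rank on any class of complete types and is the lowest dividing rank: if $R$ is a dividing rank on a class $\mathfrak A$ of complete types, then $SU^d(p)\le R(p)$ for all $p\in\mathfrak A$. (2) $SU^f$ is a forking rank on any class of complete types and is the lowest forking rank. (3) $SU^i$ is a Lascar-splitting rank on any class of complete types and is the lowest Lascar-splitting rank. (4) For any complete type $p$, $SU^d(p)\le SU^f(p)\le SU^i(p)$. (5) Any Lascar-splitting rank is a forking rank. (6) Any forking rank is a dividing rank.
   Context: $T$ is a complete first-order theory with a monster model $\mathfrak C$ (sufficiently saturated and strongly homogeneous); all parameter sets are small subsets of $\mathfrak C$. Complete types are finitary. A global type is a complete type over $\mathfrak C$. A class of complete types is a class $\mathfrak A$ of complete types closed under complete extensions and under conjugation by automorphisms of $\mathfrak C$. A rank on $\mathfrak A$ is a mapping $R:\mathfrak A\to\mathrm{Ord}\cup\{\infty\}$ with Heredity ($p\subseteq q$ implies $R(p)\ge R(q)$) and Isomorphism ($R(p)=R(p^f)$ for $f\in Aut(\mathfrak C)$); $p$ is ranked by $R$ if $R(p)<\infty$. Lascar-splitting: $Autf(\mathfrak C/A)$ is the subgroup of $Aut(\mathfrak C/A)$ generated by the automorphisms fixing pointwise some model containing $A$; $a\stackrel{Ls}{\equiv}_A b$ means $a,b$ are in the same orbit under $Autf(\mathfrak C/A)$. A complete type $p(x)$ over $B\supseteq A$ (possibly $B=\mathfrak C$) Lascar-splits over $A$ if for some $\varphi(x,y)\in L$ there are tuples $a,b\in B$ with $a\stackrel{Ls}{\equiv}_A b$,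 $\varphi(x,a)\in p$, $\neg\varphi(x,b)\in p$. For $p(x)\in S(A)$ and $q(x)\in S(B)$ with $p\subseteq q$, write: $p\,R_d\,q$ if $q$ divides over $A$; $p\,R_f\,q$ if $q$ forks over $A$; $p\,R_i\,q$ if every global extension of $q$ Lascar-splits over $A$. A rank $R$ on $\mathfrak A$ is a dividing rank (resp. forking rank, Lascar-splitting rank) if for all $p,q\in\mathfrak A$ with $p$ ranked and $p\,R_d\,q$ (resp. $p\,R_f\,q$, $p\,R_i\,q$), one has $R(p)>R(q)$. $SU^d,SU^f,SU^i$ are the foundation ranks of $R_d,R_f,R_i$ respectively; the foundation rank $SU$ of a relation $E$ is given by: $SU(p)\ge 0$; $SU(p)\ge\alpha+1$ iff there is $q$ with $p\,E\,q$ and $SU(q)\ge\alpha$; for limit $\alpha$, $SU(p)\ge\alpha$ iff $SU(p)\ge\beta$ for all $\beta<\alpha$; $SU(p)$ is the supremum of such $\alpha$, or $\infty$ if there is none. -}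

module Defs where

open import Level using (Level; _⊔_) renaming (suc to lsuc)
open import Axiom.ExcludedMiddle using (ExcludedMiddle)
open import Data.Empty.Polymorphic using (⊥)
open import Data.Fin.Base using (Fin)
open import Data.List.Base using (List; [_])
import Data.List.Relation.Unary.All as L
import Data.List.Relation.Unary.Any as L
open import Data.Nat.Base using (ℕ; suc; _+_)
open import Data.Product.Base using (Σ; ∃; _×_; _,_)
open import Data.Sum.Base using (_⊎_)
open import Data.Unit.Polymorphic using (⊤)
open import Data.Vec.Base using (Vec; []; _∷_; _++_; lookup; map)
open import Data.Vec.Properties using (map-id; map-∘; map-cong)
open import Data.Vec.Relation.Unary.All using (All)
open import Function.Base using (_∘_)
open import Function.Bundles using (_⇔_; _↔_; _↣_; Inverse; Equivalence; mk⇔)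
open import Function.Construct.Composition using (_↔-∘_)
open import Function.Construct.Identity using (↔-id; ⇔-id)
open import Function.Construct.Symmetry using (↔-sym; ⇔-sym)
open import Function.Definitions using (Injective)
open import Relation.Binary.PropositionalEquality
  using (_≡_; refl; sym; trans; cong; subst)
open import Relation.Nullary using (¬_; yes; no)
open import Relation.Unary using (Pred; _∈_; _⊆_)

------------------------------------------------------------------------
-- Cardinals.  A type stands for its cardinality; X ≺ κ means |X| < |κ|.

infix 4 _≺_

_≺_ : ∀ {x k} → Set x → Set k → Set (x ⊔ k)
X ≺ κ = (X ↣ κ) × ¬ (κ ↣ X)

-- For infinite κ this is the usual notion of regularity.
Regular : ∀ {ℓ} → Set ℓ → Set (lsuc ℓ)
Regular {ℓ} κ = {I : Set ℓ} {B : I → Set ℓ} →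
  I ≺ κ → (∀ i → B i ≺ κ) → Σ I B ≺ κ

------------------------------------------------------------------------
-- Ordinals.  sup f is the least ordinal strictly above all the f i; equality
-- of ordinals is _≈_.  Classically Ord o, modulo _≈_, is the well-ordered
-- class of all ordinals, with "set" read as "type in Set o".

data Ord (o : Level) : Set (lsuc o) where
  sup : (I : Set o) → (I → Ord o) → Ord o

module _ {o : Level} where

  infix 4 _≤_ _<_ _≈_

  _≤_ : Ord o → Ord o → Set o
  sup I f ≤ sup J g = ∀ i → Σ J λ j → f i ≤ g j

  _<_ : Ord o → Ord o → Set o
  α < sup J g = Σ J λ j → α ≤ g j

  _≈_ : Ord o → Ord o → Set o
  α ≈ β = α ≤ β × β ≤ α

  zeroₒ : Ord o
  zeroₒ = sup ⊥ λ ()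

  sucₒ : Ord o → Ord o
  sucₒ α = sup ⊤ λ _ → α

  IsLimit : Ord o → Set (lsuc o)
  IsLimit α = ¬ (α ≈ zeroₒ) × (∀ β → ¬ (α ≈ sucₒ β))

  IsSupremum : ∀ {p} → Pred (Ord o) p → Ord o → Set (lsuc o ⊔ p)
  IsSupremum P α = (∀ β → β ∈ P → β ≤ α) × (∀ γ → (∀ β → β ∈ P → β ≤ γ) → α ≤ γ)

data Ord∞ (o : Level) : Set (lsuc o) where
  ord : Ord o → Ord∞ o
  ∞   : Ord∞ o

module _ {o : Level} where

  infix 4 _≤∞_ _<∞_ _≈∞_

  _≤∞_ : Ord∞ o → Ord∞ o → Set o
  ord α ≤∞ ord β = α ≤ β
  ord α ≤∞ ∞     = ⊤
  ∞     ≤∞ ord β = ⊥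
  ∞     ≤∞ ∞     = ⊤

  _<∞_ : Ord∞ o → Ord∞ o → Set o
  ord α <∞ ord β = α < β
  ord α <∞ ∞     = ⊤
  ∞     <∞ _     = ⊥

  _≈∞_ : Ord∞ o → Ord∞ o → Set o
  r ≈∞ s = r ≤∞ s × s ≤∞ r

------------------------------------------------------------------------
-- Foundation rank of a relation

module _ {x e : Level} {X : Set x} (E : X → X → Set e) where

  -- SU≥ α p reads SU(p) ≥ α.  As the three cases are mutually exclusive and
  -- exhaustive, the inductive definition makes each defining clause an "iff".
  data SU≥ : Ord x → X → Set (lsuc x ⊔ e) where
    su-zero  : ∀ {α p} → α ≈ zeroₒ → SU≥ α p
    su-suc   : ∀ {α β p q} → α ≈ sucₒ β → E p q → SU≥ β q → SU≥ α p
    su-limit : ∀ {α p} → IsLimit α → (∀ β → β < α → SU≥ β p) → SU≥ α p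

  foundationRank : ExcludedMiddle (lsuc x ⊔ e) → X → Ord∞ x
  foundationRank em p with em {P = ∃ (IsSupremum (λ α → SU≥ α p))}
  ... | yes (α , _) = ord α
  ... | no  _       = ∞

------------------------------------------------------------------------
-- First-order logic

record Language (ℓ : Level) : Set (lsuc ℓ) where
  field
    Fun : ℕ → Set ℓ
    Rel : ℕ → Set ℓ

module _ {ℓ : Level} (L : Language ℓ) where
  open Language L

  data Term (n : ℕ) : Set ℓ where
    var : Fin n → Term n
    fun : ∀ {k} → Fun k → Vec (Term n) k → Term n

  data Formula (n : ℕ) : Set ℓ where
    _≐_ : Term n → Term n → Formula n
    rel : ∀ {k} → Rel k → Vec (Term n) k → Formula n
    ⊥′  : Formula n
    _⇒_ : Formula n → Formula n → Formula n
    all : Formula (suc n) → Formula n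

  record Structure : Set (lsuc ℓ) where
    field
      Carrier  : Set ℓ
      nonEmpty : Carrier
      ⟦_⟧ᶠ     : ∀ {k} → Fun k → Vec Carrier k → Carrier
      ⟦_⟧ʳ     : ∀ {k} → Rel k → Vec Carrier k → Set ℓ

  Theory : Set (lsuc ℓ)
  Theory = Pred (Formula 0) ℓ

infix 25 ¬′_

¬′_ : ∀ {ℓ} {L : Language ℓ} {n} → Formula L n → Formula L n
¬′ φ = φ ⇒ ⊥′

module _ {ℓ : Level} {L : Language ℓ} where
  open Structure

  module _ (M : Structure L) where

    eval  : ∀ {n} → Vec (Carrier M) n → Term L n → Carrier M
    evals : ∀ {n k} → Vec (Carrier M) n → Vec (Term L n) k → Vec (Carrier M) k
    eval v (var i)    = lookup v i
    eval v (fun F ts) = ⟦ M ⟧ᶠ F (evals v ts)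
    evals v []        = []
    evals v (t ∷ ts)  = eval v t ∷ evals v ts

    -- The bound variable of all φ is variable 0 of φ.
    Sat : ∀ {n} → Formula L n → Vec (Carrier M) n → Set ℓ
    Sat (s ≐ t)    v = eval v s ≡ eval v t
    Sat (rel R ts) v = ⟦ M ⟧ʳ R (evals v ts)
    Sat ⊥′         v = ⊥
    Sat (φ ⇒ ψ)    v = Sat φ v → Sat ψ v
    Sat (all φ)    v = ∀ c → Sat φ (c ∷ v)

    Models : Theory L → Set ℓ
    Models T = ∀ {σ} → σ ∈ T → Sat σ []

  Complete : Theory L → Set (lsuc ℓ)
  Complete T = ∀ σ → (∀ M → Models M T → Sat M σ []) ⊎ (∀ M → Models M T → Sat M (¬′ σ) [])

  ElementaryEmbedding : (M N : Structure L) → (Carrier M → Carrier N) → Set ℓ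
  ElementaryEmbedding M N h = ∀ {n} (φ : Formula L n) v → Sat M φ v ⇔ Sat N φ (map h v)

  record Automorphism (M : Structure L) : Set ℓ where
    field
      perm    : Carrier M ↔ Carrier M
      fun-hom : ∀ {k} (F : Language.Fun L k) v →
                Inverse.to perm (⟦ M ⟧ᶠ F v) ≡ ⟦ M ⟧ᶠ F (map (Inverse.to perm) v)
      rel-hom : ∀ {k} (R : Language.Rel L k) v →
                ⟦ M ⟧ʳ R v ⇔ ⟦ M ⟧ʳ R (map (Inverse.to perm) v)

    open Inverse perm public using (to; from)

  module _ {M : Structure L} where
    open Automorphism

    idᵃ : Automorphism M
    idᵃ .perm        = ↔-id _
    idᵃ .fun-hom F v = cong (⟦ M ⟧ᶠ F) (sym (map-id v))
    idᵃ .rel-hom R v = subst (λ w → ⟦ M ⟧ʳ R v ⇔ ⟦ M ⟧ʳ R w) (sym (map-id v)) (⇔-id _)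

    infixr 9 _∘ᵃ_

    _∘ᵃ_ : Automorphism M → Automorphism M → Automorphism M
    (g ∘ᵃ f) .perm        = g .perm ↔-∘ f .perm
    (g ∘ᵃ f) .fun-hom F v =
      trans (cong (to g) (fun-hom f F v))
        (trans (fun-hom g F (map (to f) v))
          (cong (⟦ M ⟧ᶠ F) (sym (map-∘ (to g) (to f) v))))
    (g ∘ᵃ f) .rel-hom R v =
      subst (λ w → ⟦ M ⟧ʳ R v ⇔ ⟦ M ⟧ʳ R w) (sym (map-∘ (to g) (to f) v))
        (mk⇔ (Equivalence.to (rel-hom g R _) ∘ Equivalence.to (rel-hom f R v))
             (Equivalence.from (rel-hom f R v) ∘ Equivalence.from (rel-hom g R _)))

    private
      map-to-from : (f : Automorphism M) → ∀ {k} (v : Vec (Carrier M) k) →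
                    map (to f) (map (from f) v) ≡ v
      map-to-from f v =
        trans (sym (map-∘ (to f) (from f) v))
          (trans (map-cong (Inverse.strictlyInverseˡ (perm f)) v) (map-id v))

    infix 10 _⁻¹ᵃ

    _⁻¹ᵃ : Automorphism M → Automorphism M
    (f ⁻¹ᵃ) .perm        = ↔-sym (f .perm)
    (f ⁻¹ᵃ) .fun-hom F v =
      trans (cong (from f ∘ ⟦ M ⟧ᶠ F) (sym (map-to-from f v)))
        (trans (cong (from f) (sym (fun-hom f F (map (from f) v))))
          (Inverse.strictlyInverseʳ (perm f) _))
    (f ⁻¹ᵃ) .rel-hom R v =
      subst (λ w → ⟦ M ⟧ʳ R w ⇔ ⟦ M ⟧ʳ R (map (from f) v)) (map-to-from f v)
        (⇔-sym (rel-hom f R (map (from f) v)))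

------------------------------------------------------------------------
-- Formulas with parameters, and monster models

module Parameters {ℓ : Level} {L : Language ℓ} (κ : Set ℓ) (ℭ : Structure L) where

  C : Set ℓ
  C = Structure.Carrier ℭ

  everything : Pred C ℓ
  everything _ = ⊤

  -- Indexed by a family because ∃ A may count elements of A several times.
  Small : Pred C ℓ → Set (lsuc ℓ)
  Small A = Σ (Set ℓ) λ I → I ≺ κ × Σ (I → C) λ f → ∀ {c} → c ∈ A → ∃ λ i → f i ≡ c

  -- φ(x,b) with x an n-tuple of variables: the first n variables of φ are
  -- x, the others are replaced by b.
  record LFormula (n : ℕ) : Set ℓ where
    constructor _⟨_⟩
    field
      {arity} : ℕ
      formula : Formula L (n + arity)
      params  : Vec C arity

  open LFormula public

  infix 4 _⊨_

  _⊨_ : ∀ {n} → Vec C n → LFormula n → Set ℓ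
  a ⊨ φ ⟨ b ⟩ = Sat ℭ φ (a ++ b)

  Over : ∀ {n} → Pred C ℓ → LFormula n → Set ℓ
  Over A χ = All A (params χ)

  neg : ∀ {n} → LFormula n → LFormula n
  neg (φ ⟨ b ⟩) = (¬′ φ) ⟨ b ⟩

  FinitelySatisfiable : ∀ {n} → Pred (LFormula n) ℓ → Set ℓ
  FinitelySatisfiable {n} p =
    ∀ χs → L.All p χs → Σ (Vec C n) λ a → L.All (a ⊨_) χs

  Saturated : Set (lsuc ℓ)
  Saturated = ∀ {n} (B : Pred C ℓ) → Small B → (p : Pred (LFormula n) ℓ) →
    p ⊆ Over B → FinitelySatisfiable p → Σ (Vec C n) λ a → ∀ {χ} → χ ∈ p → a ⊨ χ

  StronglyHomogeneous : Set (lsuc ℓ)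
  StronglyHomogeneous = (I : Set ℓ) → I ≺ κ → (a b : I → C) →
    (∀ {n} (φ : Formula L n) (v : Vec I n) → Sat ℭ φ (map a v) ⇔ Sat ℭ φ (map b v)) →
    Σ (Automorphism ℭ) λ f → ∀ i → Automorphism.to f (a i) ≡ b i

  record IsMonster : Set (lsuc ℓ) where
    field
      -- |T| is the number of formulas, i.e. |L| + ℵ₀; so κ is uncountable.
      |T|<κ       : Σ ℕ (Formula L) ≺ κ
      regular     : Regular κ
      saturated   : Saturated
      homogeneous : StronglyHomogeneous

open Parameters public using (IsMonster)

------------------------------------------------------------------------
-- Complete types and the relations R_d, R_f, R_i

module Types {ℓ : Level} {L : Language ℓ} (κ : Set ℓ) (ℭ : Structure L) where
  open Parameters κ ℭ public hiding (IsMonster)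
  open Automorphism using (to)

  record IsCompleteType {n} (A : Pred C ℓ) (p : Pred (LFormula n) ℓ) : Set ℓ where
    field
      over       : p ⊆ Over A
      consistent : FinitelySatisfiable p
      complete   : ∀ χ → Over A χ → χ ∈ p ⊎ neg χ ∈ p

  record CompleteType (n : ℕ) : Set (lsuc ℓ) where
    field
      dom       : Pred C ℓ
      small     : Small dom
      formulas  : Pred (LFormula n) ℓ
      completeT : IsCompleteType dom formulas

  open CompleteType public

  record GlobalType (n : ℕ) : Set (lsuc ℓ) where
    field
      formulasᵍ  : Pred (LFormula n) ℓ
      completeTᵍ : IsCompleteType everything formulasᵍ

  open GlobalType public

  -- The domains are then included too: c ∈ dom p iff (c ≐ c) ∈ formulas p.
  infix 4 _⊑_
  _⊑_ : ∀ {n} → CompleteType n → CompleteType n → Set ℓ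
  p ⊑ q = formulas p ⊆ formulas q

  -- q = p^f = { φ(x,f(b)) : φ(x,b) ∈ p }
  IsConjugate : ∀ {n} → Automorphism ℭ → CompleteType n → CompleteType n → Set ℓ
  IsConjugate f p q =
    ∀ {m} (φ : Formula L (_ + m)) b → φ ⟨ b ⟩ ∈ formulas p ⇔ φ ⟨ map (to f) b ⟩ ∈ formulas q

  infix 4 _⊢⋁_
  _⊢⋁_ : ∀ {n} → Pred (LFormula n) ℓ → List (LFormula n) → Set ℓ
  p ⊢⋁ χs = ∃ λ ψs → L.All p ψs × (∀ a → L.All (a ⊨_) ψs → L.Any (a ⊨_) χs)

  SameType : ∀ {m} → Pred C ℓ → Vec C m → Vec C m → Set ℓ
  SameType A b c = ∀ χ → Over A χ → (b ⊨ χ) ⇔ (c ⊨ χ)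

  -- Some sequence of realizations b i of tp(b/A) makes { φ(x,b i) : i < ω }
  -- k-inconsistent for some k.
  DividesFormula : ∀ {n} → Pred C ℓ → LFormula n → Set ℓ
  DividesFormula A (φ ⟨ b ⟩) = Σ (ℕ → Vec C _) λ bs →
    (∀ i → SameType A b (bs i)) ×
    ∃ λ k → (s : Fin k → ℕ) → Injective _≡_ _≡_ s → ¬ (∃ λ a → ∀ j → a ⊨ φ ⟨ bs (s j) ⟩)

  Divides : ∀ {n} → Pred C ℓ → Pred (LFormula n) ℓ → Set ℓ
  Divides A q = ∃ λ χ → DividesFormula A χ × q ⊢⋁ [ χ ]

  Forks : ∀ {n} → Pred C ℓ → Pred (LFormula n) ℓ → Set ℓ
  Forks A q = ∃ λ χs → L.All (DividesFormula A) χs × q ⊢⋁ χs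

  -- f fixes pointwise some (small) model containing A: the models are the
  -- images of the elementary embeddings h into ℭ.
  FixesModel : Pred C ℓ → Automorphism ℭ → Set (lsuc ℓ)
  FixesModel A f = Σ (Structure L) λ M → Structure.Carrier M ≺ κ ×
    Σ (Structure.Carrier M → C) λ h → ElementaryEmbedding M ℭ h ×
      (∀ {c} → c ∈ A → ∃ λ m → h m ≡ c) × (∀ m → to f (h m) ≡ h m)

  data Autf (A : Pred C ℓ) : Automorphism ℭ → Set (lsuc ℓ) where
    generator : ∀ {f} → FixesModel A f → Autf A f
    identity  : Autf A idᵃ
    compose   : ∀ {f g} → Autf A f → Autf A g → Autf A (g ∘ᵃ f)
    inverse   : ∀ {f} → Autf A f → Autf A (f ⁻¹ᵃ)

  _≡Ls[_]_ : ∀ {m} → Vec C m → Pred C ℓ → Vec C m → Set (lsuc ℓ)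
  a ≡Ls[ A ] b = Σ (Automorphism ℭ) λ f → Autf A f × map (to f) a ≡ b

  -- p is a type over B ⊇ A.
  LascarSplits : ∀ {n} → Pred C ℓ → Pred C ℓ → Pred (LFormula n) ℓ → Set (lsuc ℓ)
  LascarSplits {n} A B p = Σ ℕ λ m → Σ (Formula L (n + m)) λ φ →
    Σ (Vec C m) λ a → Σ (Vec C m) λ b →
    All B a × All B b × a ≡Ls[ A ] b × φ ⟨ a ⟩ ∈ p × (¬′ φ) ⟨ b ⟩ ∈ p

  TypeRelation : (e : Level) → Set (lsuc ℓ ⊔ lsuc e)
  TypeRelation e = ∀ {n} → CompleteType n → CompleteType n → Set e

  R-d : TypeRelation ℓ
  R-d p q = p ⊑ q × Divides (dom p) (formulas q)

  R-f : TypeRelation ℓ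
  R-f p q = p ⊑ q × Forks (dom p) (formulas q)

  R-i : TypeRelation (lsuc ℓ)
  R-i p q = p ⊑ q × (∀ (g : GlobalType _) → formulas q ⊆ formulasᵍ g →
                       LascarSplits (dom p) everything (formulasᵍ g))

  ----------------------------------------------------------------------
  -- Ranks.  Since CompleteType n lives in Set (lsuc ℓ), so do the index
  -- types of the ordinals.

  Ordinal∞ : Set (lsuc (lsuc ℓ))
  Ordinal∞ = Ord∞ (lsuc ℓ)

  record TypeClass (a : Level) : Set (lsuc (lsuc ℓ) ⊔ lsuc a) where
    field
      member    : ∀ {n} → Pred (CompleteType n) a
      extend    : ∀ {n} {p q : CompleteType n} → p ∈ member → p ⊑ q → q ∈ member
      conjugate : ∀ {n} {p q : CompleteType n} f → p ∈ member → IsConjugate f p q → q ∈ member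

  module _ {a : Level} (𝔄 : TypeClass a) where
    open TypeClass 𝔄

    RankFunction : Set (lsuc (lsuc ℓ) ⊔ a)
    RankFunction = ∀ {n} (p : CompleteType n) → p ∈ member → Ordinal∞

    record IsRank (R : RankFunction) : Set (lsuc ℓ ⊔ a) where
      field
        heredity    : ∀ {n} {p q : CompleteType n} (p∈ : p ∈ member) (q∈ : q ∈ member) →
                      p ⊑ q → R q q∈ ≤∞ R p p∈
        isomorphism : ∀ {n} {p q : CompleteType n} (p∈ : p ∈ member) (q∈ : q ∈ member) →
                      ∀ f → IsConjugate f p q → R p p∈ ≈∞ R q q∈

    -- A rank along E: for E = R_d, R_f, R_i these are the dividing, forking
    -- and Lascar-splitting ranks.
    record IsRankFor {e} (E : TypeRelation e) (R : RankFunction) : Set (lsuc ℓ ⊔ a ⊔ e) where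
      field
        isRank   : IsRank R
        decrease : ∀ {n} {p q : CompleteType n} (p∈ : p ∈ member) (q∈ : q ∈ member) →
                   R p p∈ <∞ ∞ → E p q → R q q∈ <∞ R p p∈

    IsDividingRank IsForkingRank : RankFunction → Set (lsuc ℓ ⊔ a)
    IsDividingRank = IsRankFor R-d
    IsForkingRank  = IsRankFor R-f

    IsLascarSplittingRank : RankFunction → Set (lsuc ℓ ⊔ a)
    IsLascarSplittingRank = IsRankFor R-i

    restrict : (∀ {n} → CompleteType n → Ordinal∞) → RankFunction
    restrict S p _ = S p

  module FoundationRanks (em : ExcludedMiddle (lsuc (lsuc ℓ))) where

    SU-d SU-f SU-i : ∀ {n} → CompleteType n → Ordinal∞
    SU-d = foundationRank R-d em
    SU-f = foundationRank R-f em
    SU-i = foundationRank R-i em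

{-# OPTIONS --safe #-}

-- If E is inherited by smaller left-hand types and is invariant under automorphisms, induction
-- on ordinals shows that its foundation rank is the least rank decreasing along E.  So all six
-- items reduce to R_d ⊆ R_f ⊆ R_i, where the second inclusion needs that a global type containing
-- a formula φ(x,b) that divides over A Lascar-splits over A.
--
-- Indiscernible sequences are not needed for this.  Let (b_i) witness k-dividing, and let M ⊇ A be
-- a small model.  By the pigeonhole principle, for every finite set of formulas over M some
-- subsequence of (b_i) has constant truth values; so saturation yields c_0, …, c_{k-1} with the
-- same type over M and the type of b over A such that {φ(x,c_j)} is inconsistent.  An automorphism
-- over A moves c_0 to b, and then all c_j are Lascar-equivalent to b over A.  A global type that
-- contains φ(x,b) without Lascar-splitting would contain every φ(x,c_j).

module Submission where

open import Defs
open import Axiom.ExcludedMiddle using (ExcludedMiddle)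
open import Data.Bool.Properties using (T-irrelevant)
open import Data.Fin.Base as Fin using (Fin; zero; suc; toℕ; combine; join; splitAt; _↑ˡ_; _↑ʳ_)
open import Data.Fin.Properties using (toℕ-injective)
open import Data.List.Base as List using (List; []; _∷_)
import Data.List.Relation.Unary.All as L
import Data.List.Relation.Unary.All.Properties as L
import Data.List.Relation.Unary.Any as Any
import Data.List.Relation.Unary.Any.Properties as Any
open import Data.Nat.Base as ℕ using (ℕ; zero; suc; _+_; _*_)
import Data.Nat.Properties as ℕ
open import Data.Product.Base using (Σ; ∃; _×_; _,_; proj₁; proj₂)
open import Data.Sum.Base as Sum using (_⊎_; inj₁; inj₂; [_,_]′)
open import Data.Unit.Polymorphic using (tt)
open import Data.Vec.Base using (Vec; []; _∷_; _++_; lookup; map; tabulate; concat)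
open import Data.Vec.Properties
  using (lookup-map; map-++; map-id; map-∘; map-cong; lookup-++ˡ; lookup-++ʳ; lookup-splitAt;
         lookup∘tabulate; tabulate∘lookup; tabulate-cong; lookup-concat)
open import Data.Vec.Relation.Unary.All as V using ([]; _∷_)
import Data.Vec.Relation.Unary.All.Properties as V
open import Function.Base using (_∘_; id)
open import Function.Bundles using (_⇔_; mk⇔; Equivalence; Inverse; _↣_; mk↣; Injection)
open import Function.Construct.Composition using (_↣-∘_)
open import Function.Definitions using (Injective)
open import Function.Properties.Inverse using (↔⇒↣)
open import Level using (Level; Lift; lift; lower; _⊔_) renaming (suc to lsuc)
open import Relation.Binary.Definitions using (tri<; tri≈; tri>)
open import Relation.Binary.PropositionalEquality
  using (_≡_; refl; sym; trans; cong; cong₂; subst)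
open import Relation.Nullary using (¬_; yes; no; contradiction)
open import Relation.Nullary.Decidable using (True; toWitness; fromWitness; decidable-stable)
open import Relation.Unary using (Pred; _∈_; _⊆_)

open Equivalence using () renaming (to to fwd; from to bwd)

-- Order properties of ordinals.

module _ {o : Level} where

  ≤-refl : {α : Ord o} → α ≤ α
  ≤-refl {sup I f} i = i , ≤-refl

  ≤-trans : {α β γ : Ord o} → α ≤ β → β ≤ γ → α ≤ γ
  ≤-trans {sup I f} {sup J g} {sup K h} α≤β β≤γ i =
    let j , fi≤gj = α≤β i
        k , gj≤hk = β≤γ j
    in k , ≤-trans fi≤gj gj≤hk

  <-≤-trans : {α β γ : Ord o} → α < β → β ≤ γ → α < γ
  <-≤-trans {β = sup J g} {sup K h} (j , α≤gj) β≤γ =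
    let k , gj≤hk = β≤γ j in k , ≤-trans α≤gj gj≤hk

  ≤-<-trans : {α β γ : Ord o} → α ≤ β → β < γ → α < γ
  ≤-<-trans {γ = sup K h} α≤β (k , β≤hk) = k , ≤-trans α≤β β≤hk

  <⇒≤ : {α β : Ord o} → α < β → α ≤ β
  <⇒≤ {sup I f} {sup J g} (j , α≤gj) i = j , <⇒≤ {f i} {g j} (<-≤-trans (i , ≤-refl) α≤gj)

  <-irrefl : {α : Ord o} → ¬ (α < α)
  <-irrefl {sup I f} (i , α≤fi) = <-irrefl {f i} (<-≤-trans (i , ≤-refl) α≤fi)

  <⇒suc≤ : {α β : Ord o} → α < β → sucₒ α ≤ β
  <⇒suc≤ {β = sup J g} α<β _ = α<β

  suc≤⇒< : {α β : Ord o} → sucₒ α ≤ β → α < β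
  suc≤⇒< {β = sup J g} sα≤β = sα≤β tt

  sup-least : ∀ {I} {f : I → Ord o} {α} → (∀ i → f i < α) → sup I f ≤ α
  sup-least {α = sup J g} f<α = f<α

-- Heights along a relation.

module _ {x e : Level} {X : Set x} (E : X → X → Set e) where

  -- "SU(p) ≥ α" by recursion on α alone, without the zero/successor/limit distinction.
  Height : Ord x → X → Set (x ⊔ e)
  Height (sup I f) p = ∀ i → ∃ λ q → E p q × Height (f i) q

  Height-antitone : ∀ {α β p} → α ≤ β → Height β p → Height α p
  Height-antitone {sup I f} {sup J g} α≤β h i =
    let j , fi≤gj = α≤β i
        q , Epq , hq = h j
    in q , Epq , Height-antitone fi≤gj hq

  Height-suc : ∀ {β p q} → E p q → Height β q → Height (sucₒ β) p
  Height-suc Epq hq _ = _ , Epq , hq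

-- Linearity of the ordinals, and foundation ranks in terms of heights.

module Classical (em : ∀ {ℓ} → ExcludedMiddle ℓ) where

  dne : ∀ {a} {P : Set a} → ¬ ¬ P → P
  dne = decidable-stable em

  ¬∀⇒∃¬ : ∀ {a b} {A : Set a} {P : A → Set b} → ¬ (∀ x → P x) → ∃ λ x → ¬ P x
  ¬∀⇒∃¬ ¬∀ = dne λ ¬∃ → ¬∀ λ x → dne λ ¬Px → ¬∃ (x , ¬Px)

  module _ {o : Level} where

    ≤-or-> : (α β : Ord o) → α ≤ β ⊎ β < α
    ≤-or-> (sup I f) (sup J g) with em {P = sup I f ≤ sup J g}
    ... | yes α≤β = inj₁ α≤β
    ... | no  α≰β =
      -- Some `f i` lies below no `g j`. By recursion every `g j` is then strictly below `f i`, so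
      -- `f i` bounds `sup J g`.
      let i , fi≰g = ¬∀⇒∃¬ α≰β
      in inj₂ (i , sup-least λ j →
           [ (λ fi≤gj → contradiction (j , fi≤gj) fi≰g) , id ]′ (≤-or-> (f i) (g j)))

    -- Reduces inequalities between ranks to single ordinals. An `∞` on the left cannot meet `ord α`
    -- on the right, since the test at `sucₒ α` would give `α < α`.
    ≤∞-fromBelow : (r s : Ord∞ o) → (∀ β → ord β ≤∞ r → ord β ≤∞ s) → r ≤∞ s
    ≤∞-fromBelow (ord α) s       below = below α ≤-refl
    ≤∞-fromBelow ∞       (ord α) below = contradiction (suc≤⇒< (below (sucₒ α) tt)) <-irrefl
    ≤∞-fromBelow ∞       ∞       below = tt

  module _ {x e : Level} {X : Set x} (E : X → X → Set e) where

    SU≥⇒Height : ∀ {α p} → SU≥ E α p → Height E α p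
    SU≥⇒Height (su-zero (α≤0 , _)) = Height-antitone E α≤0 λ ()
    SU≥⇒Height (su-suc (α≤sβ , _) Epq su) =
      Height-antitone E α≤sβ (Height-suc E Epq (SU≥⇒Height su))
    -- A limit is not the successor of `f i`, so it lies strictly above `sucₒ (f i)`. The hypothesis
    -- at that successor supplies the required `q`.
    SU≥⇒Height {sup I f} (su-limit (_ , ¬suc) below) i with ≤-or-> (sup I f) (sucₒ (f i))
    ... | inj₁ α≤sfi = contradiction (α≤sfi , <⇒suc≤ (i , ≤-refl)) (¬suc (f i))
    ... | inj₂ sfi<α = SU≥⇒Height (below _ sfi<α) tt

    -- The recursion runs on the bound `α`: the predecessor `γ` of `β` need not be a subterm of `β`,
    -- but it is bounded by some branch `f i` of `α`.
    Height⇒SU≥ : ∀ α {β p} → β ≤ α → Height E β p → SU≥ E β p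
    Height⇒SU≥ (sup I f) {β} {p} β≤α h with em {P = β ≈ zeroₒ} | em {P = ∃ λ γ → β ≈ sucₒ γ}
    ... | yes β≈0 | _ = su-zero β≈0
    ... | no _    | yes (γ , β≈sγ) =
      let q , Epq , hq = Height-antitone E (proj₂ β≈sγ) h tt
          i , γ≤fi     = <-≤-trans (suc≤⇒< (proj₂ β≈sγ)) β≤α
      in su-suc β≈sγ Epq (Height⇒SU≥ (f i) γ≤fi hq)
    ... | no β≉0  | no ¬suc = su-limit (β≉0 , λ γ eq → ¬suc (γ , eq)) λ γ γ<β →
      let i , γ≤fi = <-≤-trans γ<β β≤α
      in Height⇒SU≥ (f i) γ≤fi (Height-antitone E (<⇒≤ γ<β) h)

    private
      -- If the height fails at `i`, no E-successor of `p` has height `f i`. So `sucₒ (f i)` is not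
      -- a height of `p`, and nothing above it is.
      ¬Height⇒bound : ∀ I f {p} → ¬ Height E (sup I f) p →
                      ∃ λ i → ∀ β → Height E β p → β ≤ f i
      ¬Height⇒bound I f ¬h =
        let i , ¬hi = ¬∀⇒∃¬ ¬h
        in i , λ β hβ →
          [ id
          , (λ fi<β → contradiction (Height-antitone E (<⇒suc≤ fi<β) hβ tt) ¬hi)
          ]′ (≤-or-> β (f i))

      -- Descends from a failing ordinal: the bound `f i` is either itself a height, hence the
      -- maximum, or fails again.
      ¬Height⇒supremum : ∀ α {p} → ¬ Height E α p → ∃ (IsSupremum (λ β → SU≥ E β p))
      ¬Height⇒supremum (sup I f) {p} ¬h with ¬Height⇒bound I f ¬h
      ... | i , bound with em {P = Height E (f i) p}
      ... | yes hfi = f i , (λ β su → bound β (SU≥⇒Height su)) ,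
                            (λ γ ub → ub (f i) (Height⇒SU≥ (f i) ≤-refl hfi))
      ... | no ¬hfi = ¬Height⇒supremum (f i) ¬hfi

      -- The supremum is attained: otherwise some `f i`, strictly below it, would already bound all
      -- heights.
      supremum⇒Height : ∀ α {p} → IsSupremum (λ β → SU≥ E β p) α → Height E α p
      supremum⇒Height (sup I f) (_ , least) = dne λ ¬h →
        let i , bound = ¬Height⇒bound I f ¬h
        in <-irrefl {α = sup I f} (i , least (f i) λ β su → bound β (SU≥⇒Height su))

    -- Later arguments about `foundationRank` go through this equivalence and recurse on `Height`.
    -- When no supremum exists, `p` has every height, because one failing height would produce a
    -- supremum.
    Height⇔≤rank : ∀ β {p} → Height E β p ⇔ ord β ≤∞ foundationRank E em p
    Height⇔≤rank β {p} with em {P = ∃ (IsSupremum (λ α → SU≥ E α p))}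
    ... | yes (α , isSup) = mk⇔ (λ h → proj₁ isSup β (Height⇒SU≥ β ≤-refl h))
                                (λ β≤α → Height-antitone E β≤α (supremum⇒Height α isSup))
    ... | no ¬sup = mk⇔ (λ _ → tt) (λ _ → dne λ ¬h → ¬sup (¬Height⇒supremum β ¬h))

    rank-≤ : ∀ {p r} → (∀ β → Height E β p → ord β ≤∞ r) → foundationRank E em p ≤∞ r
    rank-≤ {p} {r} h = ≤∞-fromBelow (foundationRank E em p) r λ β β≤ → h β (bwd (Height⇔≤rank β) β≤)

    rank-decrease : ∀ {p q} → foundationRank E em p <∞ ∞ → E p q →
                    foundationRank E em q <∞ foundationRank E em p
    rank-decrease {p} {q} ranked Epq
      with foundationRank E em p | (λ β → Height⇔≤rank β {p})
         | foundationRank E em q | (λ β → Height⇔≤rank β {q})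
    ... | ord α | hp | ord β | hq =
      suc≤⇒< (fwd (hp _) (Height-suc E Epq (bwd (hq β) ≤-refl)))
    -- An unranked `q` has height `α`, the rank of `p`; then `p` has height `sucₒ α`, above its own
    -- rank.
    ... | ord α | hp | ∞     | hq =
      contradiction (suc≤⇒< (fwd (hp _) (Height-suc E Epq (bwd (hq α) tt))))
                    <-irrefl

  Height-map : ∀ {x e e′} {X : Set x} {E : X → X → Set e} {E′ : X → X → Set e′} →
               (∀ p q → E p q → E′ p q) → ∀ {α p} → Height E α p → Height E′ α p
  Height-map E⇒E′ {sup I f} h i =
    let q , Epq , hq = h i in q , E⇒E′ _ q Epq , Height-map E⇒E′ hq

≡⇒⇔ : ∀ {ℓ} {A B : Set ℓ} → A ≡ B → A ⇔ B
≡⇒⇔ refl = mk⇔ id id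

-- Renaming of variables, and elementary maps.

module _ {ℓ : Level} {L : Language ℓ} where
  open Structure

  renameTerm  : ∀ {m n} → (Fin m → Fin n) → Term L m → Term L n
  renameTerms : ∀ {m n k} → (Fin m → Fin n) → Vec (Term L m) k → Vec (Term L n) k
  renameTerm ρ (var i)    = var (ρ i)
  renameTerm ρ (fun F ts) = fun F (renameTerms ρ ts)
  renameTerms ρ []        = []
  renameTerms ρ (t ∷ ts)  = renameTerm ρ t ∷ renameTerms ρ ts

  rename : ∀ {m n} → (Fin m → Fin n) → Formula L m → Formula L n
  rename ρ (s ≐ t)    = renameTerm ρ s ≐ renameTerm ρ t
  rename ρ (rel R ts) = rel R (renameTerms ρ ts)
  rename ρ ⊥′         = ⊥′
  rename ρ (φ ⇒ ψ)    = rename ρ φ ⇒ rename ρ ψ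
  rename ρ (all φ)    = all (rename (Fin.lift 1 ρ) φ)

  module _ (M : Structure L) where

    eval-rename  : ∀ {m n} (ρ : Fin m → Fin n) {v w} → (∀ i → lookup v (ρ i) ≡ lookup w i) →
                   ∀ t → eval M v (renameTerm ρ t) ≡ eval M w t
    evals-rename : ∀ {m n k} (ρ : Fin m → Fin n) {v w} → (∀ i → lookup v (ρ i) ≡ lookup w i) →
                   ∀ (ts : Vec _ k) → evals M v (renameTerms ρ ts) ≡ evals M w ts
    eval-rename ρ v≗w (var i)    = v≗w i
    eval-rename ρ v≗w (fun F ts) = cong (⟦ M ⟧ᶠ F) (evals-rename ρ v≗w ts)
    evals-rename ρ v≗w []        = refl
    evals-rename ρ v≗w (t ∷ ts)  = cong₂ _∷_ (eval-rename ρ v≗w t) (evals-rename ρ v≗w ts)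

    Sat-rename : ∀ {m n} (ρ : Fin m → Fin n) {v w} → (∀ i → lookup v (ρ i) ≡ lookup w i) →
                 ∀ φ → Sat M (rename ρ φ) v ⇔ Sat M φ w
    Sat-rename ρ v≗w (s ≐ t) = ≡⇒⇔ (cong₂ _≡_ (eval-rename ρ v≗w s) (eval-rename ρ v≗w t))
    Sat-rename ρ v≗w (rel R ts) = ≡⇒⇔ (cong (⟦ M ⟧ʳ R) (evals-rename ρ v≗w ts))
    Sat-rename ρ v≗w ⊥′ = mk⇔ id id
    Sat-rename ρ v≗w (φ ⇒ ψ) =
      let φ⇔ = Sat-rename ρ v≗w φ
          ψ⇔ = Sat-rename ρ v≗w ψ
      in mk⇔ (λ h → fwd ψ⇔ ∘ h ∘ bwd φ⇔) (λ h → bwd ψ⇔ ∘ h ∘ fwd φ⇔)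
    Sat-rename ρ {v} {w} v≗w (all φ) =
      mk⇔ (λ h c → fwd (φ⇔ c) (h c)) (λ h c → bwd (φ⇔ c) (h c))
      where
      lifted : ∀ c i → lookup (c ∷ v) (Fin.lift 1 ρ i) ≡ lookup (c ∷ w) i
      lifted c zero    = refl
      lifted c (suc i) = v≗w i

      φ⇔ : ∀ c → Sat M (rename (Fin.lift 1 ρ) φ) (c ∷ v) ⇔ Sat M φ (c ∷ w)
      φ⇔ c = Sat-rename (Fin.lift 1 ρ) (lifted c) φ

  module _ {M N : Structure L} {h : Carrier M → Carrier N}
           (h-fun : ∀ {k} (F : Language.Fun L k) v → h (⟦ M ⟧ᶠ F v) ≡ ⟦ N ⟧ᶠ F (map h v)) where

    eval-map  : ∀ {n} (v : Vec _ n) t → h (eval M v t) ≡ eval N (map h v) t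
    evals-map : ∀ {n k} (v : Vec _ n) (ts : Vec _ k) → map h (evals M v ts) ≡ evals N (map h v) ts
    eval-map v (var i)    = sym (lookup-map i h v)
    eval-map v (fun F ts) = trans (h-fun F _) (cong (⟦ N ⟧ᶠ F) (evals-map v ts))
    evals-map v []        = refl
    evals-map v (t ∷ ts)  = cong₂ _∷_ (eval-map v t) (evals-map v ts)

    -- The test is in universal form because `all` is the primitive quantifier: it says that the
    -- image contains a counterexample whenever there is one.
    tarski-vaught :
      Injective _≡_ _≡_ h →
      (∀ {k} (R : Language.Rel L k) v → ⟦ M ⟧ʳ R v ⇔ ⟦ N ⟧ʳ R (map h v)) →
      (∀ {n} (φ : Formula L (suc n)) v → (∀ c → Sat N φ (h c ∷ map h v)) →
        Sat N (all φ) (map h v)) →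
      ElementaryEmbedding M N h
    tarski-vaught h-inj h-rel test = go
      where
      go : ElementaryEmbedding M N h
      go (s ≐ t) v = mk⇔
        (λ s≡t → trans (sym (eval-map v s)) (trans (cong h s≡t) (eval-map v t)))
        (λ s≡t → h-inj (trans (eval-map v s) (trans s≡t (sym (eval-map v t)))))
      go (rel R ts) v = mk⇔
        (subst (⟦ N ⟧ʳ R) (evals-map v ts) ∘ fwd (h-rel R _))
        (bwd (h-rel R _) ∘ subst (⟦ N ⟧ʳ R) (sym (evals-map v ts)))
      go ⊥′ v = mk⇔ (λ ()) (λ ())
      go (φ ⇒ ψ) v = mk⇔ (λ s → fwd (go ψ v) ∘ s ∘ bwd (go φ v)) (λ s → bwd (go ψ v) ∘ s ∘ fwd (go φ v))
      go (all φ) v = mk⇔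
        (λ s → test φ v (λ c → fwd (go φ (c ∷ v)) (s c)))
        (λ s c → bwd (go φ (c ∷ v)) (s (h c)))

  module _ {M : Structure L} (f : Automorphism M) where
    open Automorphism f

    to-from : ∀ c → to (from c) ≡ c
    to-from = Inverse.strictlyInverseˡ perm

    from-to : ∀ c → from (to c) ≡ c
    from-to = Inverse.strictlyInverseʳ perm

    map-to-from : ∀ {n} (v : Vec _ n) → map to (map from v) ≡ v
    map-to-from v = trans (sym (map-∘ to from v)) (trans (map-cong to-from v) (map-id v))

    map-from-to : ∀ {n} (v : Vec _ n) → map from (map to v) ≡ v
    map-from-to v = trans (sym (map-∘ from to v)) (trans (map-cong from-to v) (map-id v))

    automorphism-elementary : ElementaryEmbedding M M to
    automorphism-elementary = tarski-vaught {M = M} {N = M} fun-hom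
      (λ {c} {d} eq → trans (sym (from-to c)) (trans (cong from eq) (from-to d)))
      rel-hom
      (λ φ v s c → subst (λ d → Sat M φ (d ∷ map to v)) (to-from c) (s (from c)))

-- Conjugation of types

module Conjugation {ℓ : Level} {L : Language ℓ} (κ : Set ℓ) (ℭ : Structure L) where
  open Types κ ℭ
  open Automorphism using (to; from)

  _^_ : ∀ {n} → LFormula n → Automorphism ℭ → LFormula n
  (φ ⟨ b ⟩) ^ f = φ ⟨ map (to f) b ⟩

  ⊨-map : ∀ (f : Automorphism ℭ) {n} (a : Vec C n) χ → a ⊨ χ ⇔ map (to f) a ⊨ χ ^ f
  ⊨-map f a (φ ⟨ b ⟩) = subst (λ v → Sat ℭ φ (a ++ b) ⇔ Sat ℭ φ v) (map-++ (to f) a b)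
                          (automorphism-elementary f φ (a ++ b))

  ⊨-^ : ∀ (f : Automorphism ℭ) {n} (a : Vec C n) χ → a ⊨ χ ^ f ⇔ map (from f) a ⊨ χ
  ⊨-^ f a χ = mk⇔
    (λ sat → bwd (⊨-map f _ χ) (subst (_⊨ χ ^ f) (sym (map-to-from f a)) sat))
    (λ sat → subst (_⊨ χ ^ f) (map-to-from f a) (fwd (⊨-map f _ χ) sat))

  SameType-antitone : ∀ {A B : Pred C ℓ} {m} {b c : Vec C m} → A ⊆ B → SameType B b c → SameType A b c
  SameType-antitone A⊆B same χ χ-over = same χ (V.map A⊆B χ-over)

  SameType-sym : ∀ {A : Pred C ℓ} {m} {b c : Vec C m} → SameType A b c → SameType A c b
  SameType-sym bc χ o = mk⇔ (bwd (bc χ o)) (fwd (bc χ o))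

  c≐c : ∀ {n} → C → LFormula n
  c≐c {n} c = (var (n Fin.↑ʳ zero) ≐ var (n Fin.↑ʳ zero)) ⟨ c ∷ [] ⟩

  -- Recovers the domain from the formulas: the valid formula `c≐c c` must be in `p` as soon as `c`
  -- is an allowed parameter. Thus `⊑` and `IsConjugate`, which mention formulas only, also control
  -- domains.
  ∈dom⇔c≐c∈ : ∀ {n} (p : CompleteType n) {c} → c ∈ dom p ⇔ c≐c c ∈ formulas p
  ∈dom⇔c≐c∈ p {c} = mk⇔ dom⇒ ⇒dom
    where
    open IsCompleteType (completeT p)
    dom⇒ : c ∈ dom p → c≐c c ∈ formulas p
    dom⇒ c∈ with complete (c≐c c) (c∈ ∷ [])
    ... | inj₁ ∈p = ∈p
    ... | inj₂ ¬∈p with consistent (neg (c≐c c) ∷ []) (¬∈p L.∷ L.[])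
    ... | _ , c≢c L.∷ L.[] with c≢c refl
    ... | ()
    ⇒dom : c≐c c ∈ formulas p → c ∈ dom p
    ⇒dom ∈p with over ∈p
    ... | c∈ ∷ [] = c∈

  ⊑⇒dom⊆ : ∀ {n} {p q : CompleteType n} → p ⊑ q → dom p ⊆ dom q
  ⊑⇒dom⊆ {p = p} {q} p⊑q = bwd (∈dom⇔c≐c∈ q) ∘ p⊑q ∘ fwd (∈dom⇔c≐c∈ p)

  module _ {A B : Pred C ℓ} (A⊆B : A ⊆ B) where

    DividesFormula-antitone : ∀ {n} (χ : LFormula n) → DividesFormula B χ → DividesFormula A χ
    DividesFormula-antitone χ (bs , same , inconsistent) =
      bs , (λ i → SameType-antitone A⊆B (same i)) , inconsistent

    Autf-antitone : ∀ {f} → Autf B f → Autf A f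
    Autf-antitone (generator (M , M≺κ , h , h-elem , B⊆M , fixes)) =
      generator (M , M≺κ , h , h-elem , B⊆M ∘ A⊆B , fixes)
    Autf-antitone identity      = identity
    Autf-antitone (compose f g) = compose (Autf-antitone f) (Autf-antitone g)
    Autf-antitone (inverse f)   = inverse (Autf-antitone f)

    LascarSplits-antitone : ∀ {n D} {p : Pred (LFormula n) ℓ} → LascarSplits B D p → LascarSplits A D p
    LascarSplits-antitone (m , φ , a , b , a∈ , b∈ , (f , f∈ , fa≡b) , φ∈ , ¬φ∈) =
      m , φ , a , b , a∈ , b∈ , (f , Autf-antitone f∈ , fa≡b) , φ∈ , ¬φ∈

  -- { φ(x,b) : φ(x,f(b)) ∈ P }
  pullback : ∀ {n} → Automorphism ℭ → Pred (LFormula n) ℓ → Pred (LFormula n) ℓ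
  pullback f P (φ ⟨ b ⟩) = φ ⟨ map (to f) b ⟩ ∈ P

  -- Serves twice: with `f ⁻¹ᵃ` it builds conjugate types, and over `everything` it pulls back
  -- global types.
  pullback-isComplete : ∀ (f : Automorphism ℭ) {n A B} {P : Pred (LFormula n) ℓ} →
    (∀ {c} → c ∈ B ⇔ to f c ∈ A) → IsCompleteType A P → IsCompleteType B (pullback f P)
  pullback-isComplete f {P = P} B⇔A P-complete = record
    { over       = λ χ∈ → V.map (bwd B⇔A) (V.map⁻ (over χ∈))
    ; consistent = λ χs χs∈ →
        let a , sat = consistent (List.map (_^ f) χs) (L.map⁺ χs∈)
        in map (from f) a , L.map (λ {χ} → fwd (⊨-^ f a χ)) (L.map⁻ sat)
    ; complete   = λ χ χ-over → complete (χ ^ f) (V.map⁺ (V.map (fwd B⇔A) χ-over))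
    }
    where open IsCompleteType P-complete

  conjugateType : ∀ {n} → Automorphism ℭ → CompleteType n → CompleteType n
  conjugateType f p = record
    { dom       = dom p ∘ from f
    ; small     = let I , I≺κ , g , covers = small p in
        I , I≺κ , to f ∘ g ,
        λ {c} c∈ → let i , gi≡ = covers c∈ in i , trans (cong (to f) gi≡) (to-from f c)
    ; formulas  = pullback (f ⁻¹ᵃ) (formulas p)
    ; completeT = pullback-isComplete (f ⁻¹ᵃ) (mk⇔ id id) (completeT p)
    }

  conjugateType-isConjugate : ∀ {n} f (p : CompleteType n) → IsConjugate f p (conjugateType f p)
  conjugateType-isConjugate f p φ b =
    ≡⇒⇔ (cong (λ d → φ ⟨ d ⟩ ∈ formulas p) (sym (map-from-to f b)))

  IsConjugate-sym : ∀ {n} f {p q : CompleteType n} → IsConjugate f p q → IsConjugate (f ⁻¹ᵃ) q p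
  IsConjugate-sym f {p} {q} conj φ b = mk⇔
    (λ ∈q → bwd (conj φ _) (subst (λ d → φ ⟨ d ⟩ ∈ formulas q) (sym (map-to-from f b)) ∈q))
    (λ ∈p → subst (λ d → φ ⟨ d ⟩ ∈ formulas q) (map-to-from f b) (fwd (conj φ _) ∈p))

  module _ {n} {f : Automorphism ℭ} {p q : CompleteType n} (conj : IsConjugate f p q) where

    conjugate-dom : ∀ {c} → c ∈ dom p ⇔ to f c ∈ dom q
    conjugate-dom {c} = mk⇔
      (bwd (∈dom⇔c≐c∈ q) ∘ fwd (conj _ (c ∷ [])) ∘ fwd (∈dom⇔c≐c∈ p))
      (bwd (∈dom⇔c≐c∈ p) ∘ bwd (conj _ (c ∷ [])) ∘ fwd (∈dom⇔c≐c∈ q))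

    conjugate-⊑ : ∀ {p′ q′} → IsConjugate f p′ q′ → p ⊑ p′ → q ⊑ q′
    conjugate-⊑ {q′ = q′} conj′ p⊑p′ {φ ⟨ b ⟩} ∈q =
      subst (λ d → φ ⟨ d ⟩ ∈ formulas q′) (map-to-from f b)
        (fwd (conj′ φ _) (p⊑p′ (bwd (conj φ _)
          (subst (λ d → φ ⟨ d ⟩ ∈ formulas q) (sym (map-to-from f b)) ∈q))))

  module _ (f : Automorphism ℭ) {A B : Pred C ℓ} (A⇔B : ∀ {c} → c ∈ A ⇔ to f c ∈ B) where

    private
      B⇒A : ∀ {c} → c ∈ B → from f c ∈ A
      B⇒A {c} c∈B = bwd A⇔B (subst B (sym (to-from f c)) c∈B)

      map-B⇒A : ∀ {m} {b : Vec C m} → V.All B b → V.All A (map (from f) b)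
      map-B⇒A = V.map⁺ ∘ V.map B⇒A

    SameType-conjugate : ∀ {m} {b c : Vec C m} → SameType A b c →
                         SameType B (map (to f) b) (map (to f) c)
    SameType-conjugate {m} {b} {c} same χ@(φ ⟨ d ⟩) χ-over =
      mk⇔ (λ s → push c (fwd same′ (pull b s))) (λ s → push b (bwd same′ (pull c s)))
      where
      χ′ : LFormula m
      χ′ = φ ⟨ map (from f) d ⟩

      χ′^f≡χ : χ′ ^ f ≡ χ
      χ′^f≡χ = cong (φ ⟨_⟩) (map-to-from f d)

      same′ = same χ′ (map-B⇒A χ-over)

      pull : ∀ a → map (to f) a ⊨ χ → a ⊨ χ′
      pull a = bwd (⊨-map f a χ′) ∘ subst (map (to f) a ⊨_) (sym χ′^f≡χ)

      push : ∀ a → a ⊨ χ′ → map (to f) a ⊨ χ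
      push a = subst (map (to f) a ⊨_) χ′^f≡χ ∘ fwd (⊨-map f a χ′)

    DividesFormula-conjugate : ∀ {n} (χ : LFormula n) → DividesFormula A χ → DividesFormula B (χ ^ f)
    DividesFormula-conjugate (φ ⟨ b ⟩) (bs , same , k , inconsistent) =
      map (to f) ∘ bs , (λ i → SameType-conjugate (same i)) , k ,
      λ s s-inj (a , sat) → inconsistent s s-inj (map (from f) a , λ j → fwd (⊨-^ f a (φ ⟨ _ ⟩)) (sat j))

    -- For a generator, the conjugate fixes the image of the model under `f`. The result is
    -- described by a commutation equation because a composite of conjugates agrees with the
    -- conjugate of the composite only pointwise, whereas `Autf` is indexed by the automorphism
    -- itself.
    Autf-conjugate : ∀ {g} → Autf A g → ∃ λ g′ → Autf B g′ × (∀ c → to g′ (to f c) ≡ to f (to g c))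
    Autf-conjugate {g} (generator (M , M≺κ , h , h-elem , A⊆M , fixes)) =
      f ∘ᵃ g ∘ᵃ f ⁻¹ᵃ ,
      generator (M , M≺κ , to f ∘ h ,
        (λ φ v → let f-elem = automorphism-elementary f φ (map h v) in
          subst (λ w → Sat M φ v ⇔ Sat ℭ φ w) (sym (map-∘ (to f) h v))
            (mk⇔ (fwd f-elem ∘ fwd (h-elem φ v)) (bwd (h-elem φ v) ∘ bwd f-elem))) ,
        (λ {c} c∈B → let m , hm≡ = A⊆M (B⇒A c∈B) in m , trans (cong (to f) hm≡) (to-from f c)) ,
        (λ m → trans (cong (to f ∘ to g) (from-to f (h m))) (cong (to f) (fixes m)))) ,
      (λ c → cong (to f ∘ to g) (from-to f c))
    Autf-conjugate identity = idᵃ , identity , λ _ → refl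
    Autf-conjugate (compose {g} {h} g∈ h∈) =
      let g′ , g′∈ , g′f = Autf-conjugate g∈
          h′ , h′∈ , h′f = Autf-conjugate h∈
      in h′ ∘ᵃ g′ , compose g′∈ h′∈ , λ c → trans (cong (to h′) (g′f c)) (h′f (to g c))
    Autf-conjugate (inverse {g} g∈) =
      let g′ , g′∈ , g′f = Autf-conjugate g∈
      in g′ ⁻¹ᵃ , inverse g′∈ , λ c →
        trans (cong (from g′ ∘ to f) (sym (to-from g c)))
          (trans (cong (from g′) (sym (g′f (from g c)))) (from-to g′ _))

    ≡Ls-conjugate : ∀ {m} {a b : Vec C m} → a ≡Ls[ A ] b → map (to f) a ≡Ls[ B ] map (to f) b
    ≡Ls-conjugate {a = a} (g , g∈ , refl) =
      let g′ , g′∈ , g′f = Autf-conjugate g∈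
      in g′ , g′∈ , trans (sym (map-∘ (to g′) (to f) a))
                      (trans (map-cong g′f a) (map-∘ (to f) (to g) a))

  conjugateType-⊑ : ∀ {n} f {p q r : CompleteType n} → IsConjugate f p q → p ⊑ r → q ⊑ conjugateType f r
  conjugateType-⊑ f {p} {q} {r} conj =
    conjugate-⊑ {f = f} {p} {q} conj {r} {conjugateType f r} (conjugateType-isConjugate f r)

  ⊢⋁-conjugateType : ∀ {n} f {p : CompleteType n} χs → formulas p ⊢⋁ χs →
                     formulas (conjugateType f p) ⊢⋁ List.map (_^ f) χs
  ⊢⋁-conjugateType f {p} χs (ψs , ψs∈ , entails) =
    List.map (_^ f) ψs ,
    L.map⁺ (L.map (λ {ψ} → fwd (conjugateType-isConjugate f p (formula ψ) (params ψ))) ψs∈) ,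
    λ a sat → Any.map⁺ (Any.map (λ {χ} → bwd (⊨-^ f a χ))
      (entails (map (from f) a) (L.map (λ {ψ} → fwd (⊨-^ f a ψ)) (L.map⁻ sat))))

-- Cardinal arithmetic

≺-↣ : ∀ {x y k} {X : Set x} {Y : Set y} {κ : Set k} → X ↣ Y → Y ≺ κ → X ≺ κ
≺-↣ X↣Y (Y↣κ , κ↣̸Y) = Y↣κ ↣-∘ X↣Y , λ κ↣X → κ↣̸Y (X↣Y ↣-∘ κ↣X)

module _ {ℓ : Level} {κ : Set ℓ} (regular : Regular κ) (ℕ≺κ : Lift ℓ ℕ ≺ κ) where

  Vec-≺ : ∀ {X : Set ℓ} n → X ≺ κ → Vec X n ≺ κ
  Vec-≺ {X} zero X≺κ = ≺-↣ (mk↣ {to = λ _ → lift 0} λ { {[]} {[]} _ → refl }) ℕ≺κ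
  Vec-≺ {X} (suc n) X≺κ =
    ≺-↣ (mk↣ {to = λ { (x ∷ v) → x , v }} λ { {_ ∷ _} {_ ∷ _} refl → refl })
      (regular X≺κ λ _ → Vec-≺ n X≺κ)

  -- Regularity speaks of Σ-types, so the sum is embedded in one over ℕ, with fibre `X` at 0 and `Y`
  -- at every other index.
  ⊎-≺ : ∀ {X Y : Set ℓ} → X ≺ κ → Y ≺ κ → (X ⊎ Y) ≺ κ
  ⊎-≺ {X} {Y} X≺κ Y≺κ = ≺-↣ (mk↣ {to = tag} tag-injective) (regular ℕ≺κ fibre≺κ)
    where
    fibre : Lift ℓ ℕ → Set ℓ
    fibre (lift zero)    = X
    fibre (lift (suc _)) = Y

    fibre≺κ : ∀ i → fibre i ≺ κ
    fibre≺κ (lift zero)    = X≺κ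
    fibre≺κ (lift (suc _)) = Y≺κ

    tag : X ⊎ Y → Σ (Lift ℓ ℕ) fibre
    tag (inj₁ x) = lift 0 , x
    tag (inj₂ y) = lift 1 , y

    tag-injective : Injective _≡_ _≡_ tag
    tag-injective {inj₁ _} {inj₁ _} refl = refl
    tag-injective {inj₂ _} {inj₂ _} refl = refl

  Fin-≺ : ∀ n → Lift ℓ (Fin n) ≺ κ
  Fin-≺ n = ≺-↣ (mk↣ {to = λ i → lift (toℕ (lower i))}
                   λ eq → cong lift (toℕ-injective (cong lower eq))) ℕ≺κ

-- Homogeneous subsequences.

module Pigeonhole (em : ∀ {ℓ} → ExcludedMiddle ℓ) where
  open Classical em

  private
    mono : (t : ℕ → ℕ) → (∀ i → t i ℕ.< t (suc i)) → ∀ {i j} → i ℕ.<′ j → t i ℕ.< t j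
    mono t t< ℕ.<′-base       = t< _
    mono t t< (ℕ.<′-step i<j) = ℕ.<-trans (mono t t< i<j) (t< _)

    increasing⇒injective : (t : ℕ → ℕ) → (∀ i → t i ℕ.< t (suc i)) → Injective _≡_ _≡_ t
    increasing⇒injective t t< {i} {j} ti≡tj with ℕ.<-cmp i j
    ... | tri< i<j _ _ = contradiction ti≡tj (ℕ.<⇒≢ (mono t t< (ℕ.<⇒<′ i<j)))
    ... | tri≈ _ i≡j _ = i≡j
    ... | tri> _ _ j<i = contradiction (sym ti≡tj) (ℕ.<⇒≢ (mono t t< (ℕ.<⇒<′ j<i)))

  -- Treats one predicate at a time. If `P` holds infinitely often along `t`, the terms where it
  -- holds are selected; otherwise an initial segment is dropped and `P` fails at all remaining
  -- terms.
  homogeneousSubsequence : ∀ {a} (Ps : List (Pred ℕ a)) →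
    ∃ λ t → Injective _≡_ _≡_ t × (∀ i j → L.All (λ P → P (t i) → P (t j)) Ps)
  homogeneousSubsequence [] = id , id , λ _ _ → L.[]
  homogeneousSubsequence (P ∷ Ps) with homogeneousSubsequence Ps
  ... | t , t-inj , homog with em {P = ∀ n → ∃ λ m → n ℕ.≤ m × P (t m)}
  ... | yes often = t ∘ u , (λ eq → increasing⇒injective u u< (t-inj eq)) ,
                    λ i j → (λ _ → Pu j) L.∷ homog (u i) (u j)
    where
    u : ℕ → ℕ
    u zero    = proj₁ (often 0)
    u (suc i) = proj₁ (often (suc (u i)))

    u< : ∀ i → u i ℕ.< u (suc i)
    u< i = proj₁ (proj₂ (often (suc (u i))))

    Pu : ∀ i → P (t (u i))
    Pu zero    = proj₂ (proj₂ (often 0))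
    Pu (suc i) = proj₂ (proj₂ (often (suc (u i))))
  ... | no ¬often =
    let n , ¬m = ¬∀⇒∃¬ ¬often
    in t ∘ (n +_) , (λ eq → ℕ.+-cancelˡ-≡ n _ _ (t-inj eq)) ,
       λ i j → (λ Pi → contradiction (n + i , ℕ.m≤m+n n i , Pi) ¬m) L.∷ homog (n + i) (n + j)

-- Blocks of variables

lookup-join : ∀ {a} {A : Set a} {m n} (xs : Vec A m) (ys : Vec A n) s →
              lookup (xs ++ ys) (join m n s) ≡ [ lookup xs , lookup ys ]′ s
lookup-join xs ys (inj₁ i) = lookup-++ˡ xs ys i
lookup-join xs ys (inj₂ i) = lookup-++ʳ xs ys i

-- Saturation realizes a type in one finite tuple, so `k` tuples of length `m` are coded as a single
-- tuple of length `k * m`.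
component : ∀ {a} {A : Set a} {k m} → Fin k → Vec A (k * m) → Vec A m
component j cs = tabulate λ i → lookup cs (combine j i)

component-concat : ∀ {a} {A : Set a} {k m} (xss : Vec (Vec A m) k) j →
                   component j (concat xss) ≡ lookup xss j
component-concat xss j =
  trans (tabulate-cong (lookup-concat xss j)) (tabulate∘lookup (lookup xss j))

module _ {ℓ : Level} {L : Language ℓ} where

  alls : ∀ n {r} → Formula L (n + r) → Formula L r
  alls zero    φ = φ
  alls (suc n) φ = alls n (all φ)

  -- A negated conjunction, written as an iterated implication ending in `⊥′`.
  notAll : ∀ {n k} → (Fin k → Formula L n) → Formula L n
  notAll {k = zero}  φs = ⊥′
  notAll {k = suc k} φs = φs zero ⇒ notAll (φs ∘ suc)

  module _ (M : Structure L) where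

    Sat-alls : ∀ n {r} (φ : Formula L (n + r)) v → Sat M (alls n φ) v ⇔ (∀ a → Sat M φ (a ++ v))
    Sat-alls zero    φ v = mk⇔ (λ { s [] → s }) (λ s → s [])
    Sat-alls (suc n) φ v = mk⇔
      (λ { s (c ∷ a) → fwd (Sat-alls n (all φ) v) s a c })
      (λ s → bwd (Sat-alls n (all φ) v) λ a c → s (c ∷ a))

    Sat-notAll : ∀ {n k} (φs : Fin k → Formula L n) v →
                 Sat M (notAll φs) v ⇔ (¬ (∀ j → Sat M (φs j) v))
    Sat-notAll {k = zero}  φs v = mk⇔ (λ ()) (λ ¬all → contradiction (λ ()) ¬all)
    Sat-notAll {k = suc k} φs v = mk⇔
      (λ s sats → fwd (Sat-notAll (φs ∘ suc) v) (s (sats zero)) (sats ∘ suc))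
      (λ ¬all s → bwd (Sat-notAll (φs ∘ suc) v) λ sats →
        ¬all λ { zero → s ; (suc j) → sats j })

module Blocks {ℓ : Level} {L : Language ℓ} (κ : Set ℓ) (ℭ : Structure L) where
  open Types κ ℭ

  -- φ(y_j) as a formula in the tuple of variables y_0 … y_{k-1}
  block : ∀ {k m} → Fin k → LFormula m → LFormula (k * m)
  block {k} {m} j (φ ⟨ d ⟩) = rename (join (k * m) _ ∘ Sum.map₁ (combine j) ∘ splitAt m) φ ⟨ d ⟩

  ⊨-block : ∀ {k m} (j : Fin k) (cs : Vec C (k * m)) χ → cs ⊨ block j χ ⇔ component j cs ⊨ χ
  ⊨-block {k} {m} j cs (φ ⟨ d ⟩) = Sat-rename ℭ _
    (λ i → trans (position (splitAt m i)) (sym (lookup-splitAt m (component j cs) d i))) φ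
    where
    position : ∀ s → lookup (cs ++ d) (join (k * m) _ (Sum.map₁ (combine j) s)) ≡
                     [ lookup (component j cs) , lookup d ]′ s
    position (inj₁ i) = trans (lookup-++ˡ cs d (combine j i)) (sym (lookup∘tabulate _ i))
    position (inj₂ i) = lookup-++ʳ cs d i

  module _ n {m} (φ : Formula L (n + m)) where

    private
      -- The summand 0 is the arity of the empty parameter tuple in `inconsistency`.
      position : ∀ {k} → Fin k → Fin n ⊎ Fin m → Fin (n + (k * m + 0))
      position j = join n _ ∘ Sum.map₂ λ i → combine j i ↑ˡ 0

      instance-at : ∀ {k} → Fin k → Formula L (n + (k * m + 0))
      instance-at j = rename (position j ∘ splitAt n) φ

      Sat-instance : ∀ {k} (j : Fin k) a cs →
        Sat ℭ (instance-at j) (a ++ (cs ++ [])) ⇔ Sat ℭ φ (a ++ component j cs)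
      Sat-instance {k} j a cs = Sat-rename ℭ _
        (λ i → trans (lookup-position (splitAt n i)) (sym (lookup-splitAt n a (component j cs) i))) φ
        where
        lookup-position : ∀ s → lookup (a ++ (cs ++ [])) (position j s) ≡
                                [ lookup a , lookup (component j cs) ]′ s
        lookup-position (inj₁ i) = lookup-++ˡ a _ i
        lookup-position (inj₂ i) = trans (lookup-++ʳ a _ (combine j i ↑ˡ 0))
          (trans (lookup-++ˡ cs [] (combine j i)) (sym (lookup∘tabulate _ i)))

    -- ¬∃x ⋀ⱼ φ(x,y_j)
    inconsistency : ∀ k → LFormula (k * m)
    inconsistency k = alls n (notAll (instance-at {k})) ⟨ [] ⟩

    ⊨-inconsistency : ∀ k cs →
      cs ⊨ inconsistency k ⇔ (¬ (∃ λ (a : Vec C n) → ∀ j → a ⊨ φ ⟨ component j cs ⟩))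
    ⊨-inconsistency k cs = mk⇔
      (λ s (a , sats) → fwd (notAll⇔ a) (fwd alls⇔ s a) λ j → bwd (Sat-instance j a cs) (sats j))
      (λ ¬∃ → bwd alls⇔ λ a → bwd (notAll⇔ a) λ sats → ¬∃ (a , λ j → fwd (Sat-instance j a cs) (sats j)))
      where
      alls⇔ = Sat-alls ℭ n (notAll (instance-at {k})) (cs ++ [])
      notAll⇔ = λ a → Sat-notAll ℭ (instance-at {k}) (a ++ (cs ++ []))

module Monster (em : ∀ {ℓ} → ExcludedMiddle ℓ)
               {ℓ : Level} {L : Language ℓ} (κ : Set ℓ) (ℭ : Structure L) (monster : IsMonster κ ℭ) where
  open Classical em
  open Pigeonhole em
  open Types κ ℭ
  open Conjugation κ ℭ
  open Blocks κ ℭ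
  open IsMonster monster
  open Automorphism using (to; from; perm)

  ℕ≺κ : Lift ℓ ℕ ≺ κ
  ℕ≺κ = ≺-↣ (mk↣ {to = λ n → lower n , ⊥′} λ eq → cong lift (cong proj₁ eq)) |T|<κ

  -- Skolem hulls

  -- Skolem functions for negated universal formulas. The default value off these formulas also
  -- makes the hull nonempty.
  counterexample : ∀ {n} → Formula L n → Vec C n → C
  counterexample (all φ) v with em {P = ∃ λ c → ¬ Sat ℭ φ (c ∷ v)}
  ... | yes (c , _) = c
  ... | no  _       = Structure.nonEmpty ℭ
  counterexample _ v = Structure.nonEmpty ℭ

  counterexample-refutes : ∀ {n} (φ : Formula L (suc n)) v →
    Sat ℭ φ (counterexample (all φ) v ∷ v) → Sat ℭ (all φ) v
  counterexample-refutes φ v sat with em {P = ∃ λ c → ¬ Sat ℭ φ (c ∷ v)}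
  ... | yes (c , ¬sat) = contradiction sat ¬sat
  ... | no ¬c          = λ c → dne λ ¬sat → ¬c (c , ¬sat)

  module SkolemHull {I : Set ℓ} (I≺κ : I ≺ κ) (g : I → C) where

    -- Elements are formal Skolem expressions, and different ones may have the same value. Their
    -- number can therefore be bounded by regularity alone, stage by stage.
    Stage : ℕ → Set ℓ
    Stage zero    = I
    Stage (suc k) = Stage k ⊎ Σ (Σ ℕ (Formula L)) λ σ → Vec (Stage k) (proj₁ σ)

    value : ∀ k → Stage k → C
    value zero    i                    = g i
    value (suc k) (inj₁ s)             = value k s
    value (suc k) (inj₂ ((n , φ) , v)) = counterexample φ (map (value k) v)

    Stage-≺ : ∀ k → Stage k ≺ κ
    Stage-≺ zero    = I≺κ
    Stage-≺ (suc k) = ⊎-≺ regular ℕ≺κ (Stage-≺ k)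
      (regular |T|<κ λ σ → Vec-≺ regular ℕ≺κ (proj₁ σ) (Stage-≺ k))

    Node : Set ℓ
    Node = Σ (Lift ℓ ℕ) λ k → Stage (lower k)

    Node-≺ : Node ≺ κ
    Node-≺ = regular ℕ≺κ λ k → Stage-≺ (lower k)

    nodeValue : Node → C
    nodeValue (k , s) = value (lower k) s

    Hull : Pred C ℓ
    Hull c = ∃ λ node → nodeValue node ≡ c

    Hull-small : Small Hull
    Hull-small = Node , Node-≺ , nodeValue , id

    -- True makes membership proof-irrelevant, so that the inclusion into ℭ is injective.
    Point : Set ℓ
    Point = Σ C λ c → True (em {P = Hull c})

    point : ∀ {c} → c ∈ Hull → Point
    point c∈ = _ , fromWitness c∈

    point∈ : (x : Point) → proj₁ x ∈ Hull
    point∈ (_ , c∈) = toWitness c∈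

    proj₁-injective : Injective _≡_ _≡_ (proj₁ {B = λ c → True (em {P = Hull c})})
    proj₁-injective {c , c∈} {_ , c∈′} refl = cong (c ,_) (T-irrelevant c∈ c∈′)

    Point-≺ : Point ≺ κ
    Point-≺ = ≺-↣ (mk↣ {to = proj₁ ∘ point∈} λ {x} {y} eq → proj₁-injective
      (trans (sym (proj₂ (point∈ x))) (trans (cong nodeValue eq) (proj₂ (point∈ y))))) Node-≺

    raise : ∀ {j k} → j ℕ.≤′ k → (s : Stage j) → ∃ λ s′ → value k s′ ≡ value j s
    raise ℕ.≤′-refl       s = s , refl
    raise (ℕ.≤′-step j≤k) s = let s′ , eq = raise j≤k s in inj₁ s′ , eq

    raiseAll : ∀ {j k n} → j ℕ.≤′ k → (v : Vec (Stage j) n) →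
               ∃ λ v′ → map (value k) v′ ≡ map (value j) v
    raiseAll j≤k []      = [] , refl
    raiseAll j≤k (s ∷ v) =
      let s′ , eq = raise j≤k s
          v′ , eqs = raiseAll j≤k v
      in s′ ∷ v′ , cong₂ _∷_ eq eqs

    -- The stages are cumulative, so finitely many points all occur at the maximum of their stages.
    -- Hence their counterexamples occur one stage later.
    commonStage : ∀ {n} (v : Vec Point n) → ∃ λ k → ∃ λ w → map (value k) w ≡ map proj₁ v
    commonStage []      = 0 , [] , refl
    commonStage (x ∷ v) =
      let (j , s) , s≡ = point∈ x
          k , w , w≡   = commonStage v
          s′ , s′≡     = raise (ℕ.≤⇒≤′ (ℕ.m≤m⊔n (lower j) k)) s
          w′ , w′≡     = raiseAll (ℕ.≤⇒≤′ (ℕ.m≤n⊔m (lower j) k)) w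
      in lower j ℕ.⊔ k , s′ ∷ w′ , cong₂ _∷_ (trans s′≡ s≡) (trans w′≡ w≡)

    counterexample∈ : ∀ {n} (φ : Formula L n) (v : Vec Point n) →
                      counterexample φ (map proj₁ v) ∈ Hull
    counterexample∈ φ v =
      let k , w , w≡ = commonStage v
      in (lift (suc k) , inj₂ ((_ , φ) , w)) , cong (counterexample φ) w≡

    -- f(v) is the only counterexample to ∀y. y ≠ f(v).
    function∈ : ∀ {k} (F : Language.Fun L k) (v : Vec Point k) →
                Structure.⟦_⟧ᶠ ℭ F (map proj₁ v) ∈ Hull
    function∈ {k} F v = subst Hull c≡Fv (counterexample∈ (all φ) v)
      where
      w = map proj₁ v

      φ : Formula L (suc k)
      φ = ¬′ (var zero ≐ fun F (tabulate (var ∘ suc)))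

      evals-vars : ∀ {n m} (u : Vec C n) (ρ : Fin m → Fin n) →
                   evals ℭ u (tabulate (var ∘ ρ)) ≡ tabulate (lookup u ∘ ρ)
      evals-vars {m = zero}  u ρ = refl
      evals-vars {m = suc m} u ρ = cong (lookup u (ρ zero) ∷_) (evals-vars u (ρ ∘ suc))

      args : ∀ c → evals ℭ (c ∷ w) (tabulate (var ∘ suc)) ≡ w
      args c = trans (evals-vars (c ∷ w) suc) (tabulate∘lookup w)

      c = counterexample (all φ) w

      c≡Fv : c ≡ Structure.⟦_⟧ᶠ ℭ F w
      c≡Fv = dne λ c≢ → lower (counterexample-refutes φ w
        (λ eq → contradiction (trans eq (cong (Structure.⟦_⟧ᶠ ℭ F) (args c))) c≢)
        (Structure.⟦_⟧ᶠ ℭ F w)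
        (sym (cong (Structure.⟦_⟧ᶠ ℭ F) (args _))))

    hull : Structure L
    hull = record
      { Carrier  = Point
      ; nonEmpty = point (counterexample∈ ⊥′ [])
      ; ⟦_⟧ᶠ     = λ F v → point (function∈ F v)
      ; ⟦_⟧ʳ     = λ R v → Structure.⟦_⟧ʳ ℭ R (map proj₁ v)
      }

    hull-elementary : ElementaryEmbedding hull ℭ proj₁
    hull-elementary = tarski-vaught {M = hull} {N = ℭ} (λ F v → refl) proj₁-injective
      (λ R v → mk⇔ id id)
      (λ φ v s → counterexample-refutes φ (map proj₁ v) (s (point (counterexample∈ (all φ) v))))

  -- Homogeneity over a set of parameters

  -- Rewrites a tuple that mixes elements of `A` with entries of `a` as `a` followed by parameters
  -- `d` from `A`. As `d` and `ρ` are chosen before `a`, the same formula over `A` can be evaluated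
  -- at two different tuples.
  separateParameters : ∀ {I : Set ℓ} {m} (A : Pred C ℓ) (g : I → C) → (∀ i → g i ∈ A) →
    ∀ {n} (v : Vec (I ⊎ Lift ℓ (Fin m)) n) →
    ∃ λ r → Σ (Vec C r) λ d → V.All A d × Σ (Fin n → Fin m ⊎ Fin r) λ ρ →
      ∀ (a : Vec C m) i → [ lookup a , lookup d ]′ (ρ i) ≡
                          lookup (map [ g , lookup a ∘ lower ]′ v) i
  separateParameters A g g∈ [] = 0 , [] , [] , (λ ()) , λ a ()
  separateParameters A g g∈ (inj₁ x ∷ v) =
    let r , d , d∈ , ρ , ρ≡ = separateParameters A g g∈ v
    in suc r , g x ∷ d , g∈ x ∷ d∈ ,
       (λ { zero → inj₂ zero ; (suc i) → Sum.map₂ suc (ρ i) }) ,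
       λ { a zero → refl ; a (suc i) → trans (shift a d (ρ i)) (ρ≡ a i) }
    where
    shift : ∀ {m r c} (a : Vec C m) (d : Vec C r) s →
            [ lookup a , lookup (c ∷ d) ]′ (Sum.map₂ suc s) ≡ [ lookup a , lookup d ]′ s
    shift a d (inj₁ i) = refl
    shift a d (inj₂ i) = refl
  separateParameters A g g∈ (inj₂ x ∷ v) =
    let r , d , d∈ , ρ , ρ≡ = separateParameters A g g∈ v
    in r , d , d∈ ,
       (λ { zero → inj₁ (lower x) ; (suc i) → ρ i }) ,
       λ { a zero → refl ; a (suc i) → ρ≡ a i }

  -- Strong homogeneity is applied to two families that enumerate `A` identically and then continue
  -- with `b` and with `c`.
  homogeneousOver : ∀ {A : Pred C ℓ} {m} {b c : Vec C m} → Small A → SameType A b c →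
    ∃ λ (f : Automorphism ℭ) → (∀ {a} → a ∈ A → to f a ≡ a) × map (to f) b ≡ c
  homogeneousOver {A} {m} {b} {c} (I , I≺κ , g , covers) same =
    f , fixes , trans (map-lookup _ b) (trans (tabulate-cong λ i → f≡ (inj₂ (lift i))) (tabulate∘lookup c))
    where
    -- The covering family of A may take values outside A.
    J : Set ℓ
    J = Σ I λ i → True (em {P = g i ∈ A})

    gJ : J → C
    gJ = g ∘ proj₁

    gJ∈ : ∀ j → gJ j ∈ A
    gJ∈ (_ , i∈) = toWitness i∈

    J≺κ : J ≺ κ
    J≺κ = ≺-↣ (mk↣ {to = proj₁} λ { {i , t} {_ , t′} refl → cong (i ,_) (T-irrelevant t t′) }) I≺κ

    extension : Vec C m → J ⊎ Lift ℓ (Fin m) → C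
    extension a = [ gJ , lookup a ∘ lower ]′

    elementary : ∀ {n} (φ : Formula L n) v →
                 Sat ℭ φ (map (extension b) v) ⇔ Sat ℭ φ (map (extension c) v)
    elementary φ v with separateParameters A gJ gJ∈ v
    ... | r , d , d∈ , ρ , ρ≡ =
      let same′ = same (rename (join m r ∘ ρ) φ ⟨ d ⟩) d∈
      in mk⇔ (fwd (φ⇔ c) ∘ fwd same′ ∘ bwd (φ⇔ b)) (fwd (φ⇔ b) ∘ bwd same′ ∘ bwd (φ⇔ c))
      where
      φ⇔ : ∀ a → Sat ℭ (rename (join m r ∘ ρ) φ) (a ++ d) ⇔ Sat ℭ φ (map (extension a) v)
      φ⇔ a = Sat-rename ℭ (join m r ∘ ρ) (λ i → trans (lookup-join a d (ρ i)) (ρ≡ a i)) φ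

    auto = homogeneous (J ⊎ Lift ℓ (Fin m)) (⊎-≺ regular ℕ≺κ J≺κ (Fin-≺ regular ℕ≺κ m))
                       (extension b) (extension c) elementary
    f = proj₁ auto
    f≡ = proj₂ auto

    fixes : ∀ {a} → a ∈ A → to f a ≡ a
    fixes {a} a∈ with covers a∈
    ... | i , refl = f≡ (inj₁ (i , fromWitness a∈))

    map-lookup : ∀ {x y} {X : Set x} {Y : Set y} (h : X → Y) {n} (v : Vec X n) →
                 map h v ≡ tabulate (h ∘ lookup v)
    map-lookup h []      = refl
    map-lookup h (x ∷ v) = cong (h x ∷_) (map-lookup h v)

  -- Limits of a sequence of tuples, by saturation.

  module Limit {m} (bs : ℕ → Vec C m) (k : ℕ) where

    tuple : (Fin k → ℕ) → Vec C (k * m)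
    tuple s = concat (tabulate (bs ∘ s))

    component-tuple : ∀ s j → component j (tuple s) ≡ bs (s j)
    component-tuple s j = trans (component-concat (tabulate (bs ∘ s)) j) (lookup∘tabulate (bs ∘ s) j)

    Homogeneous : List (LFormula m) → (Fin k → ℕ) → Set ℓ
    Homogeneous Θ s = ∀ j j′ → L.All (λ θ → bs (s j) ⊨ θ → bs (s j′) ⊨ θ) Θ

    -- χ holds in every tuple that is homogeneous for some finite set Θ of formulas.  Such χ form
    -- a filter, and it contains all implications θ(y_j) → θ(y_{j′}).
    AlmostAll : LFormula (k * m) → Set ℓ
    AlmostAll χ = ∃ λ Θ → ∀ s → Injective _≡_ _≡_ s → Homogeneous Θ s → tuple s ⊨ χ

    -- The finitely many sets Θ are joined into one; the first `k` terms of a subsequence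
    -- homogeneous for it satisfy all the given formulas.
    almostAll-satisfiable : FinitelySatisfiable AlmostAll
    almostAll-satisfiable χs χs∈ =
      let Θ , sats        = common χs χs∈
          t , t-inj , hom = homogeneousSubsequence (List.map (λ θ i → bs i ⊨ θ) Θ)
      in tuple (t ∘ toℕ) , sats (t ∘ toℕ) (toℕ-injective ∘ t-inj)
           (λ j j′ → L.map⁻ (hom (toℕ j) (toℕ j′)))
      where
      common : ∀ χs → L.All AlmostAll χs →
               ∃ λ Θ → ∀ s → Injective _≡_ _≡_ s → Homogeneous Θ s → L.All (tuple s ⊨_) χs
      common []       L.[]                 = [] , λ _ _ _ → L.[]
      common (χ ∷ χs) ((Θ , sat) L.∷ χs∈) =
        let Θ′ , sats = common χs χs∈
        in Θ List.++ Θ′ , λ s s-inj hom →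
             sat s s-inj (λ j j′ → L.++⁻ˡ Θ (hom j j′)) L.∷
             sats s s-inj (λ j j′ → L.++⁻ʳ Θ (hom j j′))

    limitTuple : (B : Pred C ℓ) → Small B →
                 ∃ λ cs → ∀ χ → Over B χ → AlmostAll χ → cs ⊨ χ
    limitTuple B B-small =
      let cs , sat = saturated B B-small (λ χ → Over B χ × AlmostAll χ) proj₁
                       (λ χs χs∈ → almostAll-satisfiable χs (L.map proj₂ χs∈))
      in cs , λ χ χ-over χ∈ → sat {χ} (χ-over , χ∈)

  SameType-components : ∀ {m} {B : Pred C ℓ} k (bs : ℕ → Vec C m) (cs : Vec C (k * m)) →
    (∀ χ → Over B χ → Limit.AlmostAll bs k χ → cs ⊨ χ) →
    ∀ (j j′ : Fin k) → SameType B (component j cs) (component j′ cs)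
  SameType-components {m} {B} k bs cs limit j j′ θ θ-over = mk⇔ (transfer j j′) (transfer j′ j)
    where
    open Limit bs k

    implication : Fin k → Fin k → LFormula (k * m)
    implication i i′ = (formula (block i θ) ⇒ formula (block i′ θ)) ⟨ params θ ⟩

    ∈limit : ∀ i i′ → AlmostAll (implication i i′)
    ∈limit i i′ = List.[ θ ] , λ s s-inj hom sat →
      bwd (⊨-block i′ (tuple s) θ)
        (subst (_⊨ θ) (sym (component-tuple s i′))
          (L.head (hom i i′)
            (subst (_⊨ θ) (component-tuple s i) (fwd (⊨-block i (tuple s) θ) sat))))

    transfer : ∀ i i′ → component i cs ⊨ θ → component i′ cs ⊨ θ
    transfer i i′ sat = fwd (⊨-block i′ cs θ)
      (limit (implication i i′) θ-over (∈limit i i′) (bwd (⊨-block i cs θ) sat))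

  -- A formula over `A` true of `b` holds at every `bs i`, hence in the limit with Θ empty. The
  -- converse is the same fact for its negation.
  SameType-limit : ∀ {m} {A B : Pred C ℓ} k {b} (bs : ℕ → Vec C m) (cs : Vec C (k * m)) →
    A ⊆ B → (∀ i → SameType A b (bs i)) →
    (∀ χ → Over B χ → Limit.AlmostAll bs k χ → cs ⊨ χ) →
    ∀ j → SameType A b (component j cs)
  SameType-limit {m} {A} k {b} bs cs A⊆B same limit j θ θ-over = mk⇔
    (inLimit θ θ-over)
    (λ sat → dne λ ¬sat → lower (inLimit (neg θ) θ-over (λ s → contradiction s ¬sat) sat))
    where
    open Limit bs k

    inLimit : ∀ (θ : LFormula m) → Over A θ → b ⊨ θ → component j cs ⊨ θ
    inLimit θ θ-over sat = fwd (⊨-block j cs θ)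
      (limit (block j θ) (V.map A⊆B θ-over)
        ([] , λ s _ _ → bwd (⊨-block j (tuple s) θ)
          (subst (_⊨ θ) (sym (component-tuple s j)) (fwd (same (s j) θ θ-over) sat))))

  -- From dividing and forking to Lascar-splitting.

  divides⇒Ls-inconsistent : ∀ {A : Pred C ℓ} {n m} (φ : Formula L (n + m)) b →
    Small A → DividesFormula {n} A (φ ⟨ b ⟩) →
    ∃ λ k → Σ (Fin k → Vec C m) λ c →
      (∀ j → b ≡Ls[ A ] c j) × ¬ (∃ λ (a : Vec C n) → ∀ j → a ⊨ φ ⟨ c j ⟩)
  -- For k = 0 there is no component to move onto `b`, but the empty family is inconsistent by
  -- hypothesis.
  divides⇒Ls-inconsistent φ b _ (bs , _ , zero , inconsistent) =
    0 , (λ ()) , (λ ()) , λ (a , _) → inconsistent (λ ()) (λ { {()} }) (a , λ ())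
  divides⇒Ls-inconsistent {A} {n} {m} φ b A-small@(I , I≺κ , g , covers)
    (bs , same , k@(suc _) , inconsistent) =
    k , c , b≡Ls , c-inconsistent
    where
    open SkolemHull I≺κ g
    open Limit bs k

    A⊆Hull : A ⊆ Hull
    A⊆Hull c∈ = let i , gi≡ = covers c∈ in (lift 0 , i) , gi≡

    limitOverHull = limitTuple Hull Hull-small

    cs : Vec C (k * m)
    cs = proj₁ limitOverHull

    limit : ∀ χ → Over Hull χ → AlmostAll χ → cs ⊨ χ
    limit = proj₂ limitOverHull

    -- Component `zero` is known to share its type with `b` over `A` only, so `f` need not fix the
    -- hull. The Lascar equivalences between components are therefore established first and then
    -- transported along `f`.
    moveToB = homogeneousOver A-small (SameType-sym (SameType-limit k {b} bs cs A⊆Hull same limit zero))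

    f : Automorphism ℭ
    f = proj₁ moveToB

    f-fixes : ∀ {a} → a ∈ A → to f a ≡ a
    f-fixes = proj₁ (proj₂ moveToB)

    f-preserves : ∀ {a} → a ∈ A ⇔ to f a ∈ A
    f-preserves {a} = mk⇔
      (λ a∈ → subst A (sym (f-fixes a∈)) a∈)
      (λ fa∈ → subst A (Injection.injective (↔⇒↣ (perm f)) (f-fixes fa∈)) fa∈)

    c : Fin k → Vec C m
    c j = map (to f) (component {k = k} j cs)

    components≡Ls : ∀ j → component {k = k} zero cs ≡Ls[ A ] component {k = k} j cs
    components≡Ls j =
      let e , e-fixes , e≡ = homogeneousOver Hull-small (SameType-components k bs cs limit zero j)
      in e , generator (hull , Point-≺ , proj₁ , hull-elementary ,
                        (λ a∈ → point (A⊆Hull a∈) , refl) , λ x → e-fixes (point∈ x)) , e≡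

    b≡Ls : ∀ j → b ≡Ls[ A ] c j
    b≡Ls j = subst (_≡Ls[ A ] c j) (proj₂ (proj₂ moveToB))
               (≡Ls-conjugate f f-preserves (components≡Ls j))

    c-inconsistent : ¬ (∃ λ (a : Vec C n) → ∀ j → a ⊨ φ ⟨ c j ⟩)
    -- Any `k` terms with distinct indices are inconsistent, so `inconsistency n φ k`, which has no
    -- parameters, passes to the limit with Θ empty. A common realization for the tuples `c j` would
    -- move back along `f` to one for the components.
    c-inconsistent (a , sats) = fwd (⊨-inconsistency n φ k cs)
      (limit (inconsistency n φ k) [] ([] , λ s s-inj _ →
        bwd (⊨-inconsistency n φ k (tuple s)) λ (a , sats) →
          inconsistent s s-inj (a , λ j → subst (λ d → a ⊨ φ ⟨ d ⟩) (component-tuple s j) (sats j))))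
      (map (from f) a , λ j → fwd (⊨-^ f a (φ ⟨ component j cs ⟩)) (sats j))

  divides⇒LascarSplits : ∀ {A : Pred C ℓ} {n} (χ : LFormula n) (g : GlobalType n) → Small A →
    DividesFormula A χ → χ ∈ formulasᵍ g → LascarSplits A everything (formulasᵍ g)
  divides⇒LascarSplits {A} {n} χ@(φ ⟨ b ⟩) g A-small χ-divides χ∈g = dne λ ¬splits →
    let k , c , b≡Ls , inconsistent = divides⇒Ls-inconsistent φ b A-small χ-divides
        φc∈ : ∀ j → φ ⟨ c j ⟩ ∈ formulasᵍ g
        φc∈ j = [ id
                , (λ ¬φc∈ → contradiction
                    (_ , φ , b , c j , V.universal (λ _ → tt) b , V.universal (λ _ → tt) (c j) ,
                     b≡Ls j , χ∈g , ¬φc∈)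
                    ¬splits)
                ]′ (complete (φ ⟨ c j ⟩) (V.universal (λ _ → tt) (c j)))
        a , sats = consistent (List.tabulate λ j → φ ⟨ c j ⟩) (L.tabulate⁺ φc∈)
    in inconsistent (a , L.tabulate⁻ sats)
    where open IsCompleteType (completeTᵍ g)

  -- If `g` omitted every disjunct, it would contain their negations, and a realization of these
  -- together with `ψs` would contradict the entailment.
  ⊢⋁⇒∈ : ∀ {n} {q : Pred (LFormula n) ℓ} (g : GlobalType n) → q ⊆ formulasᵍ g →
         ∀ χs → q ⊢⋁ χs → Any.Any (_∈ formulasᵍ g) χs
  ⊢⋁⇒∈ g q⊆g χs (ψs , ψs∈ , entails) = dne λ none →
    let negs = L.map (λ {χ} χ∉ → [ (λ χ∈ → contradiction χ∈ χ∉) , id ]′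
                       (complete χ (V.universal (λ _ → tt) (params χ)))) (L.¬Any⇒All¬ χs none)
        a , sats = consistent (ψs List.++ List.map neg χs) (L.++⁺ (L.map q⊆g ψs∈) (L.map⁺ negs))
        ¬χs = L.map⁻ (L.++⁻ʳ ψs sats)
    in L.All¬⇒¬Any (L.map (λ ¬sat sat → lower (¬sat sat)) ¬χs)
                   (entails a (L.++⁻ˡ ψs sats))
    where open IsCompleteType (completeTᵍ g)

  -- Each global extension contains some dividing disjunct, possibly a different one for each
  -- extension.
  R-f⇒R-i : ∀ {n} (p q : CompleteType n) → R-f p q → R-i p q
  R-f⇒R-i p q (p⊑q , χs , χs-divide , q⊢χs) = p⊑q , λ g q⊆g →
    let χ-divides , χ∈g = L.lookupAny χs-divide (⊢⋁⇒∈ g q⊆g χs q⊢χs)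
    in divides⇒LascarSplits _ g (small p) χ-divides χ∈g

  R-d⇒R-f : ∀ {n} (p q : CompleteType n) → R-d p q → R-f p q
  R-d⇒R-f p q (p⊑q , χ , χ-divides , q⊢χ) = p⊑q , List.[ χ ] , χ-divides L.∷ L.[] , q⊢χ

-- Foundation ranks

module Ranks {ℓ : Level} {L : Language ℓ} (κ : Set ℓ) (ℭ : Structure L) where
  open Types κ ℭ
  open Conjugation κ ℭ
  open Automorphism using (to; from)

  -- What the foundation rank of `E` needs in order to be the lowest rank along `E`: `hereditary`
  -- yields Heredity, `invariant` yields Isomorphism, and `refines` keeps E-successors inside the
  -- class.
  record IsRankable {e} (E : TypeRelation e) : Set (lsuc ℓ ⊔ e) where
    field
      refines    : ∀ {n} {p q : CompleteType n} → E p q → p ⊑ q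
      hereditary : ∀ {n} {p q r : CompleteType n} → p ⊑ q → E q r → E p r
      invariant  : ∀ {n f} {p q r : CompleteType n} → IsConjugate f p q → E p r →
                   E q (conjugateType f r)

  R-d-rankable : IsRankable R-d
  R-d-rankable = record
    { refines    = proj₁
    ; hereditary = λ {_} {p} {q} p⊑q (q⊑r , χ , χ-divides , r⊢χ) →
        (λ {χ} → q⊑r ∘ p⊑q {χ}) ,
        χ , DividesFormula-antitone (⊑⇒dom⊆ {p = p} {q} p⊑q) χ χ-divides , r⊢χ
    ; invariant  = λ {_} {f} {p} {q} {r} conj (p⊑r , χ , χ-divides , r⊢χ) →
        conjugateType-⊑ f {p} {q} {r} conj p⊑r ,
        χ ^ f , DividesFormula-conjugate f (conjugate-dom {f = f} {p} {q} conj) χ χ-divides ,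
        ⊢⋁-conjugateType f {r} List.[ χ ] r⊢χ
    }

  R-f-rankable : IsRankable R-f
  R-f-rankable = record
    { refines    = proj₁
    ; hereditary = λ {_} {p} {q} p⊑q (q⊑r , χs , χs-divide , r⊢χs) →
        (λ {χ} → q⊑r ∘ p⊑q {χ}) ,
        χs , L.map (λ {χ} → DividesFormula-antitone (⊑⇒dom⊆ {p = p} {q} p⊑q) χ) χs-divide , r⊢χs
    ; invariant  = λ {_} {f} {p} {q} {r} conj (p⊑r , χs , χs-divide , r⊢χs) →
        conjugateType-⊑ f {p} {q} {r} conj p⊑r ,
        List.map (_^ f) χs ,
        L.map⁺ (L.map (λ {χ} → DividesFormula-conjugate f (conjugate-dom {f = f} {p} {q} conj) χ)
                      χs-divide) ,
        ⊢⋁-conjugateType f {r} χs r⊢χs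
    }

  R-i-rankable : IsRankable R-i
  R-i-rankable = record
    { refines    = proj₁
    ; hereditary = λ {_} {p} {q} p⊑q (q⊑r , splits) →
        (λ {χ} → q⊑r ∘ p⊑q {χ}) ,
        λ g r⊆g → LascarSplits-antitone (⊑⇒dom⊆ {p = p} {q} p⊑q) {p = formulasᵍ g} (splits g r⊆g)
    ; invariant  = λ {_} {f} {p} {q} {r} conj (p⊑r , splits) →
        conjugateType-⊑ f {p} {q} {r} conj p⊑r ,
        λ g r^f⊆g →
          -- A global extension of the conjugate of `r` pulls back to one of `r`. That one splits
          -- over `dom p`, and `f` carries the splitting pair forward.
          let g′ = record
                { formulasᵍ  = pullback f (formulasᵍ g)
                ; completeTᵍ = pullback-isComplete f (mk⇔ (λ _ → tt) (λ _ → tt)) (completeTᵍ g)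
                }
              r⊆g′ = λ {χ} χ∈ →
                r^f⊆g (fwd (conjugateType-isConjugate f r (formula χ) (params χ)) χ∈)
              m , φ , a , b , _ , _ , a≡b , φ∈ , ¬φ∈ = splits g′ (λ {χ} → r⊆g′ {χ})
          in m , φ , map (to f) a , map (to f) b ,
             V.universal (λ _ → tt) _ , V.universal (λ _ → tt) _ ,
             ≡Ls-conjugate f (conjugate-dom {f = f} {p} {q} conj) a≡b , φ∈ , ¬φ∈
    }

  module _ (em : ∀ {ℓ′} → ExcludedMiddle ℓ′) where
    open Classical em

    module _ {e} {E : TypeRelation e} (rankable : IsRankable E) where
      open IsRankable rankable

      SU : ∀ {n} → CompleteType n → Ordinal∞
      SU = foundationRank E em

      -- Only the first link of a chain starts at `q`, so one use of `hereditary` suffices without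
      -- recursion.
      Height-⊑ : ∀ {α n} {p q : CompleteType n} → p ⊑ q → Height E α q → Height E α p
      Height-⊑ {sup I f} p⊑q h i = let r , Eqr , hr = h i in r , hereditary p⊑q Eqr , hr

      Height-conjugate : ∀ {α n f} {p q : CompleteType n} → IsConjugate f p q →
                         Height E α p → Height E α q
      Height-conjugate {sup I g} {f = f} conj h i =
        let r , Epr , hr = h i
        in conjugateType f r , invariant {f = f} conj Epr ,
           Height-conjugate {g i} {f = f} (conjugateType-isConjugate f r) hr

      module _ {a} (𝔄 : TypeClass a) where
        open TypeClass 𝔄

        SU-isRankFor : IsRankFor 𝔄 E (restrict 𝔄 SU)
        SU-isRankFor = record
          { isRank = record
            { heredity    = λ {_} {p} {q} _ _ p⊑q →
                rank-≤ E λ β h → fwd (Height⇔≤rank E β) (Height-⊑ {β} {p = p} {q} p⊑q h)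
            ; isomorphism = λ {_} {p} {q} _ _ f conj →
                rank-≤ E (λ β h → fwd (Height⇔≤rank E β) (Height-conjugate {β} {f = f} {p} {q} conj h)) ,
                rank-≤ E (λ β h → fwd (Height⇔≤rank E β)
                  (Height-conjugate {β} {f = f ⁻¹ᵃ} {q} {p} (IsConjugate-sym f {p} {q} conj) h))
            }
          ; decrease = λ _ _ → rank-decrease E
          }

        module _ {R : RankFunction 𝔄} (R-rank : IsRankFor 𝔄 E R) where
          open IsRankFor R-rank

          -- By induction on `β`: each `f i` is a height of an E-successor `q` of `p`, so it is at
          -- most `R q`, which is strictly below `R p` when `p` is ranked.
          Height⇒≤R : ∀ β {n} (p : CompleteType n) p∈ → Height E β p → ord β ≤∞ R p p∈
          Height⇒≤R (sup I f) p p∈ h with R p p∈ | (λ q → decrease {p = p} {q} p∈)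
          ... | ∞ | _ = tt
          ... | ord ρ | dec = sup-least λ i →
            let q , Epq , hq = h i
                q∈ = extend p∈ (refines Epq)
            in below {R q q∈} (Height⇒≤R (f i) q q∈ hq) (dec q q∈ tt Epq)
            where
            below : ∀ {r β} → ord β ≤∞ r → r <∞ ord ρ → β < ρ
            below {ord σ} = ≤-<-trans

          SU-lowest : ∀ {n} (p : CompleteType n) p∈ → SU p ≤∞ R p p∈
          SU-lowest p p∈ = rank-≤ E λ β → Height⇒≤R β p p∈

  rank-≤-rank : ∀ (em : ∀ {ℓ′} → ExcludedMiddle ℓ′) {e e′} {E : TypeRelation e} {E′ : TypeRelation e′} →
    (∀ {n} (p q : CompleteType n) → E p q → E′ p q) →
    ∀ {n} (p : CompleteType n) → foundationRank E em p ≤∞ foundationRank E′ em p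
  rank-≤-rank em {E = E} {E′} E⇒E′ p =
    rank-≤ E λ β h → fwd (Height⇔≤rank E′ β) (Height-map E⇒E′ h)
    where open Classical em

  IsRankFor-antitone : ∀ {e e′ a} {E : TypeRelation e} {E′ : TypeRelation e′} →
    (∀ {n} (p q : CompleteType n) → E p q → E′ p q) →
    (𝔄 : TypeClass a) (R : RankFunction 𝔄) → IsRankFor 𝔄 E′ R → IsRankFor 𝔄 E R
  IsRankFor-antitone E⇒E′ 𝔄 R R-rank = record
    { isRank = isRank ; decrease = λ p∈ q∈ ranked → decrease p∈ q∈ ranked ∘ E⇒E′ _ _ }
    where open IsRankFor R-rank

mainTheorem7 :
  (em : ∀ {ℓ′} → ExcludedMiddle ℓ′) →
  ∀ {ℓ a : Level} (L : Language ℓ) (T : Theory L) → Complete T →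
  (κ : Set ℓ) (ℭ : Structure L) → Models ℭ T → IsMonster κ ℭ →
  let open Types κ ℭ
      open FoundationRanks (em {lsuc (lsuc ℓ)})
  in
  -- (1)
  (((𝔄 : TypeClass a) → IsDividingRank 𝔄 (restrict 𝔄 SU-d)) ×
   ((𝔄 : TypeClass a) (R : RankFunction 𝔄) → IsDividingRank 𝔄 R →
      ∀ {n} (p : CompleteType n) (p∈ : TypeClass.member 𝔄 p) → SU-d p ≤∞ R p p∈)) ×
  -- (2)
  (((𝔄 : TypeClass a) → IsForkingRank 𝔄 (restrict 𝔄 SU-f)) ×
   ((𝔄 : TypeClass a) (R : RankFunction 𝔄) → IsForkingRank 𝔄 R →
      ∀ {n} (p : CompleteType n) (p∈ : TypeClass.member 𝔄 p) → SU-f p ≤∞ R p p∈)) ×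
  -- (3)
  (((𝔄 : TypeClass a) → IsLascarSplittingRank 𝔄 (restrict 𝔄 SU-i)) ×
   ((𝔄 : TypeClass a) (R : RankFunction 𝔄) → IsLascarSplittingRank 𝔄 R →
      ∀ {n} (p : CompleteType n) (p∈ : TypeClass.member 𝔄 p) → SU-i p ≤∞ R p p∈)) ×
  -- (4)
  (∀ {n} (p : CompleteType n) → SU-d p ≤∞ SU-f p × SU-f p ≤∞ SU-i p) ×
  -- (5)
  ((𝔄 : TypeClass a) (R : RankFunction 𝔄) → IsLascarSplittingRank 𝔄 R → IsForkingRank 𝔄 R) ×
  -- (6)
  ((𝔄 : TypeClass a) (R : RankFunction 𝔄) → IsForkingRank 𝔄 R → IsDividingRank 𝔄 R)
mainTheorem7 em L T _ κ ℭ _ monster =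
  (SU-isRankFor em R-d-rankable , λ 𝔄 R → SU-lowest em R-d-rankable 𝔄) ,
  (SU-isRankFor em R-f-rankable , λ 𝔄 R → SU-lowest em R-f-rankable 𝔄) ,
  (SU-isRankFor em R-i-rankable , λ 𝔄 R → SU-lowest em R-i-rankable 𝔄) ,
  (λ p → rank-≤-rank em R-d⇒R-f p , rank-≤-rank em R-f⇒R-i p) ,
  IsRankFor-antitone R-f⇒R-i ,
  IsRankFor-antitone R-d⇒R-f
  where
  open Types κ ℭ
  open Ranks κ ℭ
  open Monster em κ ℭ monster
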